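{- The compact abelian embedding algorithm described in the context terminates on every finite connected graph $G$ with $n$ vertices and returns a certified isometric embedding $\phi\colon V(G)\to\mathrm{Cay}(\Gamma,S)$, with $\Gamma=\prod_i\mathbb{Z}_{N_i}$ a finite abelian group satisfying $|\Gamma|\le 2^{\,n-1}$.
   Context: $\mathrm{Cay}(\Gamma,S)$, for a generating set $S=-S\subseteq\Gamma\setminus\{0\}$ of an abelian group, is the graph on $\Gamma$ with edges $\{h,h+s\}$, $s\in S$. An isometric embedding of $G$ is an injection $\phi\colon V(G)\to\Gamma$ such that Cayley distance between images equals the shortest-path distance $d_G$. "Certified" means that the returned embedding has passed the exact check: all $\binom n2$ distances $d_G(u,v)$ are compared with the Cayley distances computed by breadth-first search (truncated at depth $\mathrm{diam}(G)$) in the candidate Cayley graph. An oriented partition is a partition $\{F_1,\dots,F_t\}$ of $E(G)$ with a chosen forward direction for each edge. Its signed cycle–class matrix $A$, with respect to an integral cycle basis $B_1,\dots,B_c$, has entries $A[i,j]$ equal to the net signed number of crossings of $F_j$ by $B_i$. Its universal group is $\Gamma_{\mathrm{univ}}=\mathbb{Z}^t/\mathrm{rowlattice}(A)\cong T\times\mathbb{Z}^f$ ($T$ finite, computed by Smith normal form), with class generators $g_j$ the images of the standard basis vectors and vertex labels given by signed sums of class generators along paths from a root. A fold is the quotient by a finite-index sublattice $L\subseteq\mathbb{Z}^f$, with induced labels and connection set the nonzero images of the $\pm g_j$. Algorithm (input: a finite connected graph $G$). (1) Compute all pairwise distances and the diameter. (2) Build a finite list (portfolio) of initial oriented partitions of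 $G$. (3) For each initial partition, repeat: compute the universal group, generators and labels; search folds in increasing host order up to a fixed cap on the host order, enumerating sublattices by Hermite-normal-form bases and applying the exact check to each candidate; if a candidate passes, record $(\Gamma,S,\phi)$ and leave the loop; otherwise repair the partition by peeling one edge off a largest class into a singleton class, and leave the loop if all classes are singletons. (4) Binary terminal: form the finest-partition binary quotient, i.e. take each edge as its own class, with generator $g_e$ the image of the basis vector of $e$ in $\mathbb{F}_2^{E}/\mathcal{Z}(G)$ ($\mathcal{Z}(G)$ the cycle space over $\mathbb{F}_2$), and label $v$ by the sum of the $g_e$ along a path from the root to $v$; record this host after applying the exact check to it. (5) Return the smallest recorded verified host. -}

module Defs where

open import Algebra.Bundles using (AbelianGroup)
open import Algebra.Definitions.RawMonoid using (sum)
import Algebra.Construct.DirectProduct as DirectProduct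
import Algebra.Construct.Pointwise as Pointwise
open import Algebra.Morphism.Structures using (IsGroupHomomorphism)
open import Data.Bool.Base using (Bool; if_then_else_; _∨_)
open import Data.Fin.Base as Fin using (Fin; zero; suc; toℕ)
import Data.Fin.Properties as Fin
open import Data.Integer.Base as ℤ using (ℤ; +_; 0ℤ; 1ℤ)
import Data.Integer.Properties as ℤ
open import Data.List.Base as List
  using (List; []; _∷_; _++_; [_]; concatMap; filter; deduplicate; allFin; upTo;
         cartesianProductWith; foldr; length)
open import Data.List.Membership.Propositional using (_∈_)
import Data.List.Membership.DecPropositional as DecMembership
open import Data.List.Relation.Unary.All using (All; []; _∷_)
open import Data.List.Relation.Unary.Linked using (Linked)
open import Data.List.Relation.Unary.Unique.Propositional using (Unique)
open import Data.Maybe.Base using (Maybe; just; nothing)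
open import Data.Nat.Base as ℕ using (ℕ; zero; suc; NonZero; _≤_; _∸_)
import Data.Nat.Properties as ℕ
open import Data.Nat.ListAction using (product)
open import Data.Nat.Divisibility using (_∣_; _∣?_)
open import Data.Nat.DivMod
  using (_/_; _%_; _mod_; %-distribˡ-+; m%n%n≡m%n; m<n⇒m%n≡m; n%n≡0; m%n<n)
open import Data.Product.Base using (∃-syntax; Σ-syntax; _×_; _,_)
open import Data.Sign.Base as Sign using (Sign)
open import Data.Vec.Base as Vec using (Vec; []; _∷_)
import Data.Vec.Relation.Unary.All as VecAll
import Data.Vec.Relation.Unary.All.Properties as VecAll
open import Function.Base using (_∘_)
open import Function.Bundles using (_⇔_)
open import Function.Definitions using (Injective; Surjective)
open import Level using (0ℓ)
open import Relation.Binary.Construct.Closure.ReflexiveTransitive using (Star; ε; _◅_; fold)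
open import Relation.Binary.Core using (Rel)
open import Relation.Binary.Definitions using (DecidableEquality)
open import Relation.Binary.PropositionalEquality
  using (_≡_; _≢_; refl; sym; trans; cong; cong₂; isEquivalence; module ≡-Reasoning)
open import Relation.Nullary.Decidable.Core using (does; yes; no; ¬?)
open import Relation.Nullary.Negation.Core using (¬_)
open import Relation.Unary using (Pred)

module _ (N : ℕ) .{{_ : NonZero N}} where

  module Modular where

    _⊕_ : Fin N → Fin N → Fin N
    a ⊕ b = (toℕ a ℕ.+ toℕ b) mod N

    ⊖_ : Fin N → Fin N
    ⊖ a = (N ∸ toℕ a) mod N

    0# : Fin N
    0# = 0 mod N

    toℕ-mod : ∀ k → toℕ (k mod N) ≡ k % N
    toℕ-mod k = Fin.toℕ-fromℕ< (m%n<n k N)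

    toℕ-% : ∀ (a : Fin N) → toℕ a % N ≡ toℕ a
    toℕ-% a = m<n⇒m%n≡m (Fin.toℕ<n a)

    mod-cong : ∀ {j k} → j % N ≡ k % N → j mod N ≡ k mod N
    mod-cong {j} {k} eq = Fin.toℕ-injective (trans (toℕ-mod j) (trans eq (sym (toℕ-mod k))))

    mod-toℕ : ∀ (a : Fin N) → toℕ a mod N ≡ a
    mod-toℕ a = Fin.toℕ-injective (trans (toℕ-mod (toℕ a)) (toℕ-% a))

    %-+ˡ : ∀ j k → (j % N ℕ.+ k) % N ≡ (j ℕ.+ k) % N
    %-+ˡ j k = begin
      (j % N ℕ.+ k) % N            ≡⟨ %-distribˡ-+ (j % N) k N ⟩
      (j % N % N ℕ.+ k % N) % N    ≡⟨ cong (λ x → (x ℕ.+ k % N) % N) (m%n%n≡m%n j N) ⟩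
      (j % N ℕ.+ k % N) % N        ≡⟨ %-distribˡ-+ j k N ⟨
      (j ℕ.+ k) % N                ∎
      where
      open ≡-Reasoning

    ⊕-comm : ∀ a b → a ⊕ b ≡ b ⊕ a
    ⊕-comm a b = cong (_mod N) (ℕ.+-comm (toℕ a) (toℕ b))

    ⊕-assoc : ∀ a b c → (a ⊕ b) ⊕ c ≡ a ⊕ (b ⊕ c)
    ⊕-assoc a b c = mod-cong (begin
      (toℕ (a ⊕ b) ℕ.+ toℕ c) % N              ≡⟨ cong (λ x → (x ℕ.+ toℕ c) % N) (toℕ-mod (toℕ a ℕ.+ toℕ b)) ⟩
      ((toℕ a ℕ.+ toℕ b) % N ℕ.+ toℕ c) % N    ≡⟨ %-+ˡ (toℕ a ℕ.+ toℕ b) (toℕ c) ⟩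
      (toℕ a ℕ.+ toℕ b ℕ.+ toℕ c) % N          ≡⟨ cong (_% N) (trans (ℕ.+-assoc (toℕ a) (toℕ b) (toℕ c)) (ℕ.+-comm (toℕ a) _)) ⟩
      (toℕ b ℕ.+ toℕ c ℕ.+ toℕ a) % N          ≡⟨ %-+ˡ (toℕ b ℕ.+ toℕ c) (toℕ a) ⟨
      ((toℕ b ℕ.+ toℕ c) % N ℕ.+ toℕ a) % N    ≡⟨ cong (_% N) (trans (ℕ.+-comm _ (toℕ a)) (cong (toℕ a ℕ.+_) (sym (toℕ-mod (toℕ b ℕ.+ toℕ c))))) ⟩
      (toℕ a ℕ.+ toℕ (b ⊕ c)) % N              ∎)
      where
      open ≡-Reasoning

    ⊕-identityˡ : ∀ a → 0# ⊕ a ≡ a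
    ⊕-identityˡ a = trans (mod-cong (trans (cong (λ x → (x ℕ.+ toℕ a) % N) (toℕ-mod 0)) (%-+ˡ 0 (toℕ a)))) (mod-toℕ a)

    ⊕-inverseˡ : ∀ a → (⊖ a) ⊕ a ≡ 0#
    ⊕-inverseˡ a = mod-cong (begin
      (toℕ (⊖ a) ℕ.+ toℕ a) % N           ≡⟨ cong (λ x → (x ℕ.+ toℕ a) % N) (toℕ-mod (N ∸ toℕ a)) ⟩
      ((N ∸ toℕ a) % N ℕ.+ toℕ a) % N     ≡⟨ %-+ˡ (N ∸ toℕ a) (toℕ a) ⟩
      (N ∸ toℕ a ℕ.+ toℕ a) % N           ≡⟨ cong (_% N) (ℕ.m∸n+n≡m (ℕ.<⇒≤ (Fin.toℕ<n a))) ⟩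
      N % N                               ≡⟨ n%n≡0 N ⟩
      0                                   ≡⟨ m<n⇒m%n≡m (ℕ.>-nonZero⁻¹ N) ⟨
      0 % N                               ∎)
      where
      open ≡-Reasoning

  open Modular

  ℤ/ : AbelianGroup 0ℓ 0ℓ
  ℤ/ = record
    { Carrier = Fin N ; _≈_ = _≡_ ; _∙_ = _⊕_ ; ε = 0# ; _⁻¹ = ⊖_
    ; isAbelianGroup = record
      { isGroup = record
        { isMonoid = record
          { isSemigroup = record
            { isMagma = record { isEquivalence = isEquivalence ; ∙-cong = cong₂ _⊕_ }
            ; assoc = ⊕-assoc }
          ; identity = ⊕-identityˡ , λ a → trans (⊕-comm a 0#) (⊕-identityˡ a) }
        ; inverse = ⊕-inverseˡ , λ a → trans (⊕-comm a (⊖ a)) (⊕-inverseˡ a)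
        ; ⁻¹-cong = cong ⊖_ }
      ; comm = ⊕-comm } }

-- An element of ℤ/N₁ × ⋯ × ℤ/Nᵣ is an  All Fin (N₁ ∷ ⋯ ∷ Nᵣ ∷ []).

module Product where

  module C (N : ℕ) (nz : NonZero N) = AbelianGroup (ℤ/ N {{nz}})

  add : ∀ {Ns} → All NonZero Ns → All Fin Ns → All Fin Ns → All Fin Ns
  add []         []       []       = []
  add (nz ∷ nzs) (a ∷ as) (b ∷ bs) = C._∙_ _ nz a b ∷ add nzs as bs

  zeros : ∀ {Ns} → All NonZero Ns → All Fin Ns
  zeros []         = []
  zeros (nz ∷ nzs) = C.ε _ nz ∷ zeros nzs

  neg : ∀ {Ns} → All NonZero Ns → All Fin Ns → All Fin Ns
  neg []         []       = []
  neg (nz ∷ nzs) (a ∷ as) = C._⁻¹ _ nz a ∷ neg nzs as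

  comm : ∀ {Ns} nzs (a b : All Fin Ns) → add nzs a b ≡ add nzs b a
  comm []         []       []       = refl
  comm (nz ∷ nzs) (a ∷ as) (b ∷ bs) = cong₂ _∷_ (C.comm _ nz a b) (comm nzs as bs)

  assoc : ∀ {Ns} nzs (a b c : All Fin Ns) → add nzs (add nzs a b) c ≡ add nzs a (add nzs b c)
  assoc []         []       []       []       = refl
  assoc (nz ∷ nzs) (a ∷ as) (b ∷ bs) (c ∷ cs) = cong₂ _∷_ (C.assoc _ nz a b c) (assoc nzs as bs cs)

  identityˡ : ∀ {Ns} nzs (a : All Fin Ns) → add nzs (zeros nzs) a ≡ a
  identityˡ []         []       = refl
  identityˡ (nz ∷ nzs) (a ∷ as) = cong₂ _∷_ (C.identityˡ _ nz a) (identityˡ nzs as)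

  inverseˡ : ∀ {Ns} nzs (a : All Fin Ns) → add nzs (neg nzs a) a ≡ zeros nzs
  inverseˡ []         []       = refl
  inverseˡ (nz ∷ nzs) (a ∷ as) = cong₂ _∷_ (C.inverseˡ _ nz a) (inverseˡ nzs as)

∏ℤ/ : (Ns : List ℕ) → All NonZero Ns → AbelianGroup 0ℓ 0ℓ
∏ℤ/ Ns nzs = record
  { Carrier = All Fin Ns ; _≈_ = _≡_ ; _∙_ = add nzs ; ε = zeros nzs ; _⁻¹ = neg nzs
  ; isAbelianGroup = record
    { isGroup = record
      { isMonoid = record
        { isSemigroup = record
          { isMagma = record { isEquivalence = isEquivalence ; ∙-cong = cong₂ (add nzs) }
          ; assoc = assoc nzs }
        ; identity = identityˡ nzs , λ a → trans (comm nzs a _) (identityˡ nzs a) }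
      ; inverse = inverseˡ nzs , λ a → trans (comm nzs a _) (inverseˡ nzs a)
      ; ⁻¹-cong = cong (neg nzs) }
    ; comm = comm nzs } }
  where
  open Product

∏-≟ : ∀ {Ns} → DecidableEquality (All Fin Ns)
∏-≟ []       []       = yes refl
∏-≟ (a ∷ as) (b ∷ bs) with a Fin.≟ b | ∏-≟ as bs
... | yes refl | yes refl = yes refl
... | no a≢b   | _        = no λ { refl → a≢b refl }
... | yes _    | no as≢bs = no λ { refl → as≢bs refl }

ℤ^ : ℕ → AbelianGroup 0ℓ 0ℓ
ℤ^ t = Pointwise.abelianGroup (Fin t) ℤ.+-0-abelianGroup

𝔽₂^ : ℕ → AbelianGroup 0ℓ 0ℓ
𝔽₂^ t = Pointwise.abelianGroup (Fin t) (ℤ/ 2)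

_⊞_ : AbelianGroup 0ℓ 0ℓ → AbelianGroup 0ℓ 0ℓ → AbelianGroup 0ℓ 0ℓ
_⊞_ = DirectProduct.abelianGroup

-- An isomorphism G / H ≅ Q, given as the surjection G → Q with kernel H.
record Quotient (G : AbelianGroup 0ℓ 0ℓ) (H : Pred (AbelianGroup.Carrier G) 0ℓ)
                (Q : AbelianGroup 0ℓ 0ℓ) : Set where
  private
    module G = AbelianGroup G
    module Q = AbelianGroup Q
  field
    ⟦_⟧                 : G.Carrier → Q.Carrier
    isGroupHomomorphism : IsGroupHomomorphism G.rawGroup Q.rawGroup ⟦_⟧
    surjective          : Surjective G._≈_ Q._≈_ ⟦_⟧
    kernel              : ∀ x → ⟦ x ⟧ Q.≈ Q.ε ⇔ H x

Matrix : ℕ → ℕ → Set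
Matrix c t = Fin c → Fin t → ℤ

combination : ∀ {c t} → (Fin c → ℤ) → Matrix c t → Fin t → ℤ
combination y A j = sum (AbelianGroup.rawMonoid ℤ.+-0-abelianGroup) (λ i → y i ℤ.* A i j)

RowLattice : ∀ {c t} → Matrix c t → Pred (Fin t → ℤ) 0ℓ
RowLattice A x = ∃[ y ] (∀ j → x j ≡ combination y A j)

δ : ∀ {t} → Fin t → Fin t → ℤ
δ j k = if does (j Fin.≟ k) then 1ℤ else 0ℤ

δ₂ : ∀ {t} → Fin t → Fin t → Fin 2
δ₂ j k = if does (j Fin.≟ k) then suc zero else zero

-- Bases of the finite-index sublattices of ℤᶠ in (row) Hermite normal form:
-- upper triangular, with positive diagonal, and with each entry above a
-- diagonal entry reduced modulo it.  In  row a H b  the first row is (a , b),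
-- and H is the lower right block.

data HNF : ℕ → Set
diagonal : ∀ {f} → HNF f → Vec ℕ f

data HNF where
  []  : HNF 0
  row : ∀ {f} (a : ℕ) .{{_ : NonZero a}} (H : HNF f) (b : VecAll.All Fin (diagonal H)) → HNF (suc f)

diagonal []          = []
diagonal (row a H b) = a ∷ diagonal H

matrix : ∀ {f} → HNF f → Matrix f f
matrix (row a H b) zero    zero    = + a
matrix (row a H b) zero    (suc j) = + toℕ (VecAll.lookup⁺ b j)
matrix (row a H b) (suc i) zero    = 0ℤ
matrix (row a H b) (suc i) (suc j) = matrix H i j

tuples : ∀ {f} (Ns : Vec ℕ f) → List (VecAll.All Fin Ns)
tuples []       = [ VecAll.[] ]
tuples (N ∷ Ns) = cartesianProductWith VecAll._∷_ (allFin N) (tuples Ns)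

hermite : (f d : ℕ) → List (HNF f)
hermite zero    1 = [ [] ]
hermite zero    _ = []
hermite (suc f) d =
  concatMap (λ k → concatMap (λ H → List.map (row (suc k) H) (tuples (diagonal H)))
                             (hermite f (d / suc k)))
            (filter (λ k → suc k ∣? d) (upTo d))

-- All sublattices of index d with o * d ≤ cap, by increasing d.
sublattices : (cap o f : ℕ) → List (HNF f)
sublattices cap o f =
  concatMap (hermite f) (filter (λ d → o ℕ.* d ℕ.≤? cap) (List.map suc (upTo cap)))

module _ {A : Set} {R : Rel A 0ℓ} where

  walkLength : ∀ {u v} → Star R u v → ℕ
  walkLength ε       = 0
  walkLength (_ ◅ w) = suc (walkLength w)

  starts : ∀ {u v} → Star R u v → List A
  starts ε                 = []
  starts (_◅_ {i = u} _ w) = u ∷ starts w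

Distance : ∀ {A : Set} → Rel A 0ℓ → A → A → ℕ → Set
Distance R u v d = (Σ[ w ∈ Star R u v ] walkLength w ≡ d) × (∀ (w : Star R u v) → d ≤ walkLength w)

module BFS {A : Set} (_≟_ : DecidableEquality A) (neighbours : A → List A) where

  open DecMembership _≟_ using (_∈?_)

  next : (frontier visited : List A) → List A
  next frontier visited =
    deduplicate _≟_ (filter (λ x → ¬? (x ∈? visited)) (concatMap neighbours frontier))

  -- k is the depth of the frontier, and fuel the number of further levels.
  search : (fuel k : ℕ) (frontier visited : List A) → A → Maybe ℕ
  search zero k frontier visited v =
    if does (v ∈? frontier) then just k else nothing
  search (suc fuel) k frontier visited v =
    if does (v ∈? frontier) then just k else
    search fuel (suc k) (next frontier visited) (visited ++ next frontier visited) v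

  distance : (depth : ℕ) → A → A → Maybe ℕ
  distance depth u v = search depth 0 [ u ] [ u ] v

-- A simple graph: edge e is the unordered pair {src e, tgt e}, listed with
-- src e < tgt e.
record Graph (n : ℕ) : Set where
  field
    edges    : ℕ
    src tgt  : Fin edges → Fin n
    src<tgt  : ∀ e → src e Fin.< tgt e
    distinct : ∀ {e e′} → src e ≡ src e′ → tgt e ≡ tgt e′ → e ≡ e′

  E : Set
  E = Fin edges

  data Arc : Rel (Fin n) 0ℓ where
    along   : ∀ e → Arc (src e) (tgt e)
    against : ∀ e → Arc (tgt e) (src e)

  edgeOf : ∀ {u v} → Arc u v → E
  edgeOf (along e)   = e
  edgeOf (against e) = e

  traversal : E → ∀ {u v} → Arc u v → ℤ
  traversal e (along e′)   = δ e e′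
  traversal e (against e′) = ℤ.- δ e e′

  Walk : Rel (Fin n) 0ℓ
  Walk = Star Arc

  Connected : Set
  Connected = ∀ u v → Walk u v

  module _ (Γ : AbelianGroup 0ℓ 0ℓ) where

    open AbelianGroup Γ using (Carrier; _∙_) renaming (ε to 0#)

    walkSum : (∀ {u v} → Arc u v → Carrier) → ∀ {u v} → Walk u v → Carrier
    walkSum weight = fold (λ _ _ → Carrier) (λ a x → weight a ∙ x) 0#

  incident : E → Fin n → Bool
  incident e v = does (src e Fin.≟ v) ∨ does (tgt e Fin.≟ v)

  -- The cycle space over 𝔽₂: edge sets meeting every vertex in an even number
  -- of edges.
  CycleSpace : Pred (E → Fin 2) 0ℓ
  CycleSpace x = ∀ v → sum 𝔽₂.rawMonoid (λ e → if incident e v then x e else 𝔽₂.ε) ≡ 𝔽₂.ε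
    where
    module 𝔽₂ = AbelianGroup (ℤ/ 2)

  record Cycle : Set where
    field
      {base}     : Fin n
      walk       : Walk base base
      simple     : Unique (starts walk)
      nontrivial : 3 ≤ walkLength walk

    chain : E → ℤ
    chain e = walkSum ℤ.+-0-abelianGroup (traversal e) walk

  record IntegralCycleBasis : Set where
    field
      {size}      : ℕ
      cycle       : Fin size → Cycle
      independent : ∀ y → (∀ e → combination y (Cycle.chain ∘ cycle) e ≡ 0ℤ) → ∀ i → y i ≡ 0ℤ
      spanning    : ∀ (Z : Cycle) → ∃[ y ] (∀ e → Cycle.chain Z e ≡ combination y (Cycle.chain ∘ cycle) e)

  record Labelling : Set where
    field
      root : Fin n
      path : ∀ v → Walk root v

  -- forward e is + when the forward direction of e is from src e to tgt e.
  record OrientedPartition : Set where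
    field
      {classes} : ℕ
      class     : E → Fin classes
      nonempty  : ∀ j → ∃[ e ] class e ≡ j
      forward   : E → Sign

    classSize : Fin classes → ℕ
    classSize j = length (filter (λ e → class e Fin.≟ j) (allFin edges))

    AllSingletons : Set
    AllSingletons = ∀ {e e′} → class e ≡ class e′ → e ≡ e′

    module _ (Γ : AbelianGroup 0ℓ 0ℓ) where

      open AbelianGroup Γ using (Carrier; _⁻¹)

      signed : Sign → Carrier → Carrier
      signed Sign.+ x = x
      signed Sign.- x = x ⁻¹

      crossing : (Fin classes → Carrier) → ∀ {u v} → Arc u v → Carrier
      crossing g (along e)   = signed (forward e) (g (class e))
      crossing g (against e) = signed (Sign.opposite (forward e)) (g (class e))

      signedSum : (Fin classes → Carrier) → ∀ {u v} → Walk u v → Carrier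
      signedSum g = walkSum Γ (crossing g)

    cycleClassMatrix : (B : IntegralCycleBasis) → Matrix (IntegralCycleBasis.size B) classes
    cycleClassMatrix B i j =
      signedSum ℤ.+-0-abelianGroup (δ j) (Cycle.walk (IntegralCycleBasis.cycle B i))

  -- Move the edge e out of its class, which also contains e′, into a new one.
  peel : (P : OrientedPartition) → ∀ e e′ → e ≢ e′ →
         OrientedPartition.class P e ≡ OrientedPartition.class P e′ → OrientedPartition
  peel P e e′ e≢e′ same = record
    { class = class′ ; nonempty = nonempty′ ; forward = forward }
    where
    open OrientedPartition P
    class′ : E → Fin (suc classes)
    class′ x = if does (x Fin.≟ e) then zero else suc (class x)

    at-e : class′ e ≡ zero
    at-e with e Fin.≟ e
    ... | yes _  = refl
    ... | no e≢e with () ← e≢e refl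

    off-e : ∀ x → x ≢ e → class′ x ≡ suc (class x)
    off-e x x≢e with x Fin.≟ e
    ... | no _ = refl
    ... | yes x≡e with () ← x≢e x≡e

    nonempty′ : ∀ j → ∃[ x ] class′ x ≡ j
    nonempty′ zero    = e , at-e
    nonempty′ (suc j) with nonempty j
    ... | x , refl with x Fin.≟ e
    ...   | no x≢e   = x , off-e x x≢e
    ...   | yes refl = e′ , trans (off-e e′ (e≢e′ ∘ sym)) (cong suc (sym same))

record Host (n : ℕ) : Set where
  field
    moduli  : List ℕ
    nonZero : All NonZero moduli

  Γ : AbelianGroup 0ℓ 0ℓ
  Γ = ∏ℤ/ moduli nonZero

  open AbelianGroup Γ public using (Carrier; _∙_; _⁻¹) renaming (ε to 0#)

  field
    S : List Carrier
    φ : Fin n → Carrier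

  order : ℕ
  order = product moduli

  Cay : Rel Carrier 0ℓ
  Cay h k = ∃[ s ] (s ∈ S × k ≡ h ∙ s)

  record IsConnectionSet : Set where
    field
      symmetric  : ∀ {s} → s ∈ S → s ⁻¹ ∈ S
      nonzero    : ∀ {s} → s ∈ S → s ≢ 0#
      generating : ∀ h → ∃[ ss ] (All (_∈ S) ss × h ≡ foldr _∙_ 0# ss)

  bfsDistance : (depth : ℕ) → Carrier → Carrier → Maybe ℕ
  bfsDistance = BFS.distance ∏-≟ (λ h → List.map (h ∙_) S)

module _ (Ns : List ℕ) (nzs : All NonZero Ns) where

  open AbelianGroup (∏ℤ/ Ns nzs) using (Carrier; _⁻¹) renaming (ε to 0#)

  connectionSet : ∀ {t} → (Fin t → Carrier) → List Carrier
  connectionSet {t} g =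
    filter (λ s → ¬? (∏-≟ s 0#)) (concatMap (λ j → g j ∷ (g j) ⁻¹ ∷ []) (allFin t))

-- The algorithm, as a nondeterministic transition system.  Everything that is
-- left open (portfolio, cycle bases, roots and paths, coordinates on quotient
-- groups, which edge of which largest class to peel, ties) is an arbitrary
-- choice of the transition concerned.

module Algorithm {n : ℕ} (G : Graph n) (cap : ℕ) where

  open Graph G
  open OrientedPartition using (class; classSize; AllSingletons)

  record Metric : Set where
    field
      dist          : Fin n → Fin n → ℕ
      isDistance    : ∀ u v → Distance Arc u v (dist u v)
      diam          : ℕ
      dist≤diam     : ∀ u v → dist u v ≤ diam
      diam-attained : ∃[ u ] ∃[ v ] dist u v ≡ diam

  ExactCheck : Metric → Host n → Set
  ExactCheck μ h = ∀ u v → u Fin.< v → bfsDistance diam (φ u) (φ v) ≡ just (dist u v)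
    where
    open Metric μ
    open Host h

  IsIsometricEmbedding : Host n → Set
  IsIsometricEmbedding h =
    Injective _≡_ _≡_ φ ×
    (∀ u v → ∃[ d ] (Distance Arc u v d × Distance Cay (φ u) (φ v) d))
    where
    open Host h

  -- The invariants are those of the Smith normal form: each divides the next.
  record UniversalGroup (P : OrientedPartition) : Set where
    open OrientedPartition P
    field
      basis      : IntegralCycleBasis
      invariants : List ℕ
      nonZero    : All NonZero invariants
      divisible  : Linked _∣_ invariants
      rank       : ℕ

    T : AbelianGroup 0ℓ 0ℓ
    T = ∏ℤ/ invariants nonZero

    Γᵤₙᵢᵥ : AbelianGroup 0ℓ 0ℓ
    Γᵤₙᵢᵥ = T ⊞ ℤ^ rank

    field
      quotient  : Quotient (ℤ^ classes) (RowLattice (cycleClassMatrix basis)) Γᵤₙᵢᵥ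
      labelling : Labelling

    open Quotient quotient
    open Labelling labelling

    generator : Fin classes → AbelianGroup.Carrier Γᵤₙᵢᵥ
    generator j = ⟦ δ j ⟧

    label : Fin n → AbelianGroup.Carrier Γᵤₙᵢᵥ
    label v = signedSum Γᵤₙᵢᵥ generator (path v)

    orderT : ℕ
    orderT = product invariants

    folds : List (HNF rank)
    folds = sublattices cap orderT rank

  record Fold {P : OrientedPartition} (U : UniversalGroup P) (H : HNF (UniversalGroup.rank U)) : Set where
    open UniversalGroup U using (T; Γᵤₙᵢᵥ; generator; label)

    L : Pred (AbelianGroup.Carrier Γᵤₙᵢᵥ) 0ℓ
    L (x , y) = AbelianGroup._≈_ T x (AbelianGroup.ε T) × RowLattice (matrix H) y

    field
      moduli   : List ℕ
      nonZero  : All NonZero moduli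
      quotient : Quotient Γᵤₙᵢᵥ L (∏ℤ/ moduli nonZero)

    open Quotient quotient

    host : Host n
    host = record
      { moduli = moduli ; nonZero = nonZero
      ; S = connectionSet moduli nonZero (⟦_⟧ ∘ generator)
      ; φ = ⟦_⟧ ∘ label }

  record BinaryQuotient : Set where
    field
      moduli    : List ℕ
      nonZero   : All NonZero moduli
      quotient  : Quotient (𝔽₂^ edges) CycleSpace (∏ℤ/ moduli nonZero)
      labelling : Labelling

    open Quotient quotient
    open Labelling labelling

    generator : E → All Fin moduli
    generator e = ⟦ δ₂ e ⟧

    host : Host n
    host = record
      { moduli = moduli ; nonZero = nonZero
      ; S = connectionSet moduli nonZero generator
      ; φ = λ v → walkSum (∏ℤ/ moduli nonZero) (λ a → generator (edgeOf a)) (path v) }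

  Portfolio Hosts : Set
  Portfolio = List OrientedPartition
  Hosts     = List (Host n)

  data State : Set where
    start     : State
    measured  : Metric → State
    portfolio : Metric → Portfolio → Hosts → State
    loop      : Metric → OrientedPartition → Portfolio → Hosts → State
    folding   : Metric → (P : OrientedPartition) (U : UniversalGroup P) →
                List (HNF (UniversalGroup.rank U)) → Portfolio → Hosts → State
    repair    : Metric → OrientedPartition → Portfolio → Hosts → State
    repaired  : Metric → OrientedPartition → Portfolio → Hosts → State
    select    : Metric → Hosts → State
    return    : Metric → Host n → State

  infix 4 _⟶_

  data _⟶_ : Rel State 0ℓ where

    measure : ∀ μ → start ⟶ measured μ

    build : ∀ {μ} ps → measured μ ⟶ portfolio μ ps []

    next : ∀ {μ P ps hs} → portfolio μ (P ∷ ps) hs ⟶ loop μ P ps hs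

    universal : ∀ {μ P ps hs} (U : UniversalGroup P) →
      loop μ P ps hs ⟶ folding μ P U (UniversalGroup.folds U) ps hs

    fold-pass : ∀ {μ P U H Hs ps hs} (F : Fold U H) → ExactCheck μ (Fold.host F) →
      folding μ P U (H ∷ Hs) ps hs ⟶ portfolio μ ps (Fold.host F ∷ hs)

    fold-fail : ∀ {μ P U H Hs ps hs} (F : Fold U H) → ¬ ExactCheck μ (Fold.host F) →
      folding μ P U (H ∷ Hs) ps hs ⟶ folding μ P U Hs ps hs

    exhausted : ∀ {μ P U ps hs} → folding μ P U [] ps hs ⟶ repair μ P ps hs

    peel-edge : ∀ {μ P ps hs} e e′ (e≢e′ : e ≢ e′) (same : class P e ≡ class P e′) →
      (∀ j → classSize P j ≤ classSize P (class P e)) →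
      repair μ P ps hs ⟶ repaired μ (peel P e e′ e≢e′ same) ps hs

    nothing-to-peel : ∀ {μ P ps hs} → AllSingletons P →
      repair μ P ps hs ⟶ repaired μ P ps hs

    leave : ∀ {μ P ps hs} → AllSingletons P →
      repaired μ P ps hs ⟶ portfolio μ ps hs

    again : ∀ {μ P ps hs} → ¬ AllSingletons P →
      repaired μ P ps hs ⟶ loop μ P ps hs

    terminal-pass : ∀ {μ hs} (B : BinaryQuotient) → ExactCheck μ (BinaryQuotient.host B) →
      portfolio μ [] hs ⟶ select μ (BinaryQuotient.host B ∷ hs)

    terminal-fail : ∀ {μ hs} (B : BinaryQuotient) → ¬ ExactCheck μ (BinaryQuotient.host B) →
      portfolio μ [] hs ⟶ select μ hs

    smallest : ∀ {μ hs h} → h ∈ hs → All (λ h′ → Host.order h ≤ Host.order h′) hs →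
      select μ hs ⟶ return μ h

  -- Every maximal run from the given state is finite and ends by returning a
  -- host satisfying Post; in particular no run gets stuck before returning.
  data EveryRunReturns (Post : Metric → Host n → Set) : State → Set where
    returned : ∀ {μ h} → Post μ h → EveryRunReturns Post (return μ h)
    step     : ∀ {s} → ∃[ s′ ] s ⟶ s′ → (∀ {s′} → s ⟶ s′ → EveryRunReturns Post s′) →
               EveryRunReturns Post s

module Submission where

-- The binary host always passes the exact check: its quotient map identifies
-- 𝔽₂^E / 𝒵(G) with the image of the boundary map in 𝔽₂^V, so a Cayley walk of
-- length k from φ u to φ v is a list of k edges with boundary u + v, and such a
-- list contains a walk from u to v.  The image consists of even vertex sets and
-- is isomorphic to 𝔽₂^(n-1), which bounds the order of the smallest recorded host.
-- No run gets stuck: adding the edges one at a time, each edge inside a component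
-- closes a new basic cycle and each bridge contributes none, which gives an
-- integral cycle basis; universal groups and folds exist by reduction to Smith
-- normal form.  Runs are finite because every peeling adds a class, and there are
-- at most as many classes as edges.

open import Defs
open import Data.Nat.Base using (ℕ; NonZero; _≤_; _^_; _∸_)
open import Data.Product.Base using (_×_)
open import Algebra.Bundles using (AbelianGroup; CommutativeMonoid)
open import Algebra.Definitions.RawMonoid using (sum)
import Algebra.Properties.CommutativeMonoid.Sum as Sum
import Algebra.Properties.Semiring.Sum as SemiringSum
import Algebra.Properties.AbelianGroup as AbelianGroupProperties
open import Algebra.Morphism.Structures using (IsGroupHomomorphism)
open import Data.Bool.Base using (true; false; if_then_else_)
open import Data.Empty using (⊥-elim)
open import Data.Fin.Base as Fin using (Fin; zero; suc; toℕ)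
import Data.Fin.Properties as Fin
open import Data.Integer.Base as ℤ using (ℤ; +_; 0ℤ; 1ℤ; ∣_∣)
import Data.Integer.Properties as ℤ
import Data.Integer.DivMod as ℤ
open import Data.Integer.Divisibility.Signed as ℤ∣ using (divides)
open import Data.Integer.Tactic.RingSolver using (solve-∀)
open import Data.List.Base as List
  using (List; []; _∷_; _++_; [_]; concatMap; filter; allFin; foldr; length)
open import Data.List.Membership.Propositional using (_∈_; _∉_; find; lose)
import Data.List.Membership.DecPropositional as DecMembership
open import Data.List.Membership.Propositional.Properties
  using (∈-map⁺; ∈-map⁻; ∈-++⁺ˡ; ∈-++⁺ʳ; ∈-++⁻; ∈-filter⁺; ∈-filter⁻; ∈-deduplicate⁺; ∈-deduplicate⁻;
         ∈-concatMap⁺; ∈-concatMap⁻; ∈-allFin)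
open import Data.List.Relation.Unary.All as All using (All; []; _∷_)
import Data.List.Relation.Unary.All.Properties as All
open import Data.List.Relation.Unary.AllPairs using ([]; _∷_)
open import Data.List.Relation.Unary.Any using (here; there)
open import Data.List.Relation.Unary.Linked using (Linked; []; [-]; _∷_)
open import Data.List.Relation.Unary.Unique.Propositional using (Unique)
import Data.List.Relation.Unary.Unique.Propositional.Properties as Unique
open import Data.Maybe.Base using (just)
import Data.Maybe.Properties as Maybe
open import Data.Nat.Base as ℕ using (zero; suc; z≤n; s≤s)
import Data.Nat.Properties as ℕ
import Data.Nat.DivMod as ℕ
import Data.Nat.Divisibility as ℕ∣
open import Data.Nat.Induction using (<-wellFounded)
open import Data.Nat.ListAction using (product)
open import Data.Product.Base using (∃-syntax; Σ-syntax; _,_; proj₁; proj₂)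
open import Data.Sum.Base using (_⊎_; inj₁; inj₂)
import Data.Vec.Functional as Vector
import Data.Vec.Functional.Properties as Vector
import Data.Vec.Relation.Unary.All.Properties as VecAll
open import Function.Base using (_∘_; id; case_of_)
open import Function.Bundles using (_⇔_; mk⇔; module Equivalence; module Inverse)
open import Function.Definitions using (Injective)
open import Induction.WellFounded using (Acc; acc)
open import Level using (0ℓ)
open import Relation.Binary.Construct.Closure.ReflexiveTransitive using (Star; ε; _◅_; _◅◅_; gmap)
open import Relation.Binary.Core using (Rel)
open import Relation.Binary.Definitions using (DecidableEquality; Symmetric; tri<; tri≈; tri>)
open import Relation.Binary.PropositionalEquality
  using (_≡_; _≢_; refl; sym; trans; cong; cong₂; subst; subst₂; ≢-sym; module ≡-Reasoning)
open import Relation.Nullary.Decidable using (Dec; does; yes; no; ¬?; _×-dec_; _⊎-dec_; _→-dec_; map′; decidable-stable)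
open import Relation.Nullary.Negation using (¬_; contradiction)
open import Relation.Unary using (Pred)

-- Walks, distances and breadth-first search

-- The transitions leave coordinates on quotients, cycle bases and root paths open. Properties of a
-- host are therefore derived from the kernel of an arbitrary quotient map, and explicit
-- constructions enter where a transition has to be shown to exist or sizes are compared. At a fold
-- either outcome of the exact check is possible, so progress there rests on the check being
-- decidable. The terminal step guarantees a nonempty record even if every fold has failed, so the
-- selection cannot get stuck. The exact check compares only pairs `u < v`, by a truncated search.
-- Turning it into an isometry takes the soundness of that search and the closure of `S` under
-- inverses. For the cycle basis, the induction over edges cannot stay within cycles, because
-- subtracting a multiple of one simple cycle from another rarely leaves a simple cycle; spanning is
-- therefore proved for all closed chains.

module _ {A : Set} {R : Rel A 0ℓ} where

  walkLength-◅◅ : ∀ {u v w} (p : Star R u v) (q : Star R v w) →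
                  walkLength (p ◅◅ q) ≡ walkLength p ℕ.+ walkLength q
  walkLength-◅◅ ε       q = refl
  walkLength-◅◅ (a ◅ p) q = cong suc (walkLength-◅◅ p q)

  unsnoc : ∀ {u v k} (w : Star R u v) → walkLength w ≡ suc k →
           ∃[ x ] (Σ[ p ∈ Star R u x ] walkLength p ≡ k) × R x v
  unsnoc (a ◅ ε)     refl = _ , (ε , refl) , a
  unsnoc (a ◅ b ◅ w) refl with unsnoc (b ◅ w) refl
  ... | x , (p , eq) , c = x , (a ◅ p , cong suc eq) , c

  snoc : ∀ {u v x} (w : Star R u v) → R v x → Σ[ p ∈ Star R u x ] walkLength p ≡ suc (walkLength w)
  snoc w a = w ◅◅ a ◅ ε , trans (walkLength-◅◅ w (a ◅ ε)) (ℕ.+-comm _ 1)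

  reversal : Symmetric R → ∀ {u v} (w : Star R u v) → Σ[ p ∈ Star R v u ] walkLength p ≡ walkLength w
  reversal sy ε = ε , refl
  reversal sy (a ◅ w) with reversal sy w
  ... | p , eq with snoc p (sy a)
  ... | q , eq′ = q , trans eq′ (cong suc eq)

  Distance-sym : Symmetric R → ∀ {u v d} → Distance R u v d → Distance R v u d
  Distance-sym sy ((w , eq) , min) with reversal sy w
  ... | p , eq′ = (p , trans eq′ eq) , λ q → case reversal sy q of λ where
    (q′ , eq″) → subst (_ ≤_) eq″ (min q′)

  Distance-unique : ∀ {u v d d′} → Distance R u v d → Distance R u v d′ → d ≡ d′
  Distance-unique ((w , refl) , min) ((w′ , refl) , min′) = ℕ.≤-antisym (min w′) (min′ w)

  Distance-refl : ∀ {u} → Distance R u u 0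
  Distance-refl = (ε , refl) , λ _ → z≤n

  -- Loop erasure: if the first vertex recurs later, only the suffix from that recurrence is kept.
  -- `starts` omits the final vertex, so its absence from the list is recorded separately; closing
  -- the path up to a simple cycle needs it.
  simplePath : DecidableEquality A → ∀ {u v} → Star R u v →
               Σ[ p ∈ Star R u v ] Unique (starts p) × v ∉ starts p
  simplePath _≟_ ε = ε , [] , λ ()
  simplePath _≟_ {u} {v} (a ◅ w) with simplePath _≟_ w
  ... | p , uniq , v∉p with u ≟ v
  ...   | yes refl = ε , [] , λ ()
  ...   | no u≢v with DecMembership._∈?_ _≟_ u (starts p)
  ...     | no u∉p = a ◅ p , All.¬Any⇒All¬ _ u∉p ∷ uniq , λ where
              (here v≡u) → u≢v (sym v≡u)
              (there v∈p) → v∉p v∈p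
  ...     | yes u∈p = suffix p uniq v∉p u∈p
    where
    suffix : ∀ {x v} (p : Star R x v) → Unique (starts p) → v ∉ starts p → u ∈ starts p →
             Σ[ q ∈ Star R u v ] Unique (starts q) × v ∉ starts q
    suffix (b ◅ q) uniq         v∉ (here refl) = b ◅ q , uniq , v∉
    suffix (b ◅ q) (_ ∷ uniq) v∉ (there u∈q) = suffix q uniq (v∉ ∘ there) u∈q

module _ {A : Set} {R R′ : Rel A 0ℓ} (f : ∀ {x y} → R x y → R′ x y) where

  starts-gmap : ∀ {u v} (w : Star R u v) → starts (gmap id f w) ≡ starts w
  starts-gmap ε       = refl
  starts-gmap (a ◅ w) = cong (_ ∷_) (starts-gmap w)

  walkLength-gmap : ∀ {u v} (w : Star R u v) → walkLength (gmap id f w) ≡ walkLength w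
  walkLength-gmap ε       = refl
  walkLength-gmap (a ◅ w) = cong suc (walkLength-gmap w)

module BFSCorrectness {A : Set} (_≟_ : DecidableEquality A) (neighbours : A → List A) {R : Rel A 0ℓ}
  (adjacent : ∀ {x y} → R x y ⇔ y ∈ neighbours x) (u : A) where

  open BFS _≟_ neighbours
  open DecMembership _≟_ using (_∈?_)

  IsFrontier IsVisited : ℕ → List A → Set
  IsFrontier k F = ∀ x → x ∈ F ⇔ Distance R u x k
  IsVisited  k V = ∀ x → x ∈ V ⇔ (Σ[ w ∈ Star R u x ] walkLength w ≤ k)

  module _ {k F V} (isF : IsFrontier k F) (isV : IsVisited k V) where

    private
      module F x = Equivalence (isF x)
      module V x = Equivalence (isV x)

    -- The frontier is a sphere and the visited list a ball. A neighbour of the sphere outside the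
    -- ball has no walk of length at most `k`. Conversely, the last vertex but one of a shortest
    -- walk lies on the sphere, since a shorter walk to it would shorten the whole.
    next-frontier : IsFrontier (suc k) (next F V)
    next-frontier x = mk⇔ to from
      where
      to : x ∈ next F V → Distance R u x (suc k)
      to x∈ with ∈-filter⁻ (λ x → ¬? (x ∈? V)) {xs = concatMap neighbours F} (∈-deduplicate⁻ _≟_ _ x∈)
      ... | x∈′ , x∉V with find (∈-concatMap⁻ neighbours {xs = F} x∈′)
      ...   | y , y∈F , x∈N with F.to y y∈F
      ...     | (w , refl) , _ = snoc w (Equivalence.from adjacent x∈N)
              , λ p → ℕ.≰⇒> λ p≤k → x∉V (V.from x (p , p≤k))

      from : Distance R u x (suc k) → x ∈ next F V
      from ((w , eq) , min) with unsnoc w eq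
      ... | y , (p , refl) , a = ∈-deduplicate⁺ _≟_ (∈-filter⁺ (λ x → ¬? (x ∈? V))
        (∈-concatMap⁺ neighbours (lose (F.from y ((p , refl) , shortest)) (Equivalence.to adjacent a)))
        (λ x∈V → case V.to x x∈V of λ where (q , q≤k) → ℕ.<⇒≱ (min q) q≤k))
        where
        shortest : ∀ (q : Star R u y) → walkLength p ≤ walkLength q
        shortest q with snoc q a
        ... | q′ , eq′ = ℕ.s≤s⁻¹ (subst (suc (walkLength p) ≤_) eq′ (min q′))

    next-visited : IsVisited (suc k) (V ++ next F V)
    next-visited x = mk⇔ to from
      where
      to : x ∈ V ++ next F V → Σ[ w ∈ Star R u x ] walkLength w ≤ suc k
      to x∈ with ∈-++⁻ V x∈
      ... | inj₁ x∈V with V.to x x∈V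
      ...   | w , w≤k = w , ℕ.m≤n⇒m≤1+n w≤k
      to x∈ | inj₂ x∈N with Equivalence.to (next-frontier x) x∈N
      ...   | (w , eq) , _ = w , ℕ.≤-reflexive eq

      from : Σ[ w ∈ Star R u x ] walkLength w ≤ suc k → x ∈ V ++ next F V
      from (w , w≤) with x ∈? V
      ... | yes x∈V = ∈-++⁺ˡ x∈V
      ... | no  x∉V = ∈-++⁺ʳ V (Equivalence.from (next-frontier x) ((w , ℕ.≤-antisym w≤ (far w)) , far))
        where
        far : ∀ (q : Star R u x) → suc k ≤ walkLength q
        far q = ℕ.≰⇒> λ q≤k → x∉V (V.from x (q , q≤k))

  search-sound : ∀ fuel {k F V v d} → IsFrontier k F → IsVisited k V →
                 search fuel k F V v ≡ just d → Distance R u v d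
  search-sound zero {F = F} {v = v} isF isV eq with v ∈? F
  search-sound zero isF isV refl | yes v∈F = Equivalence.to (isF _) v∈F
  search-sound (suc fuel) {F = F} {v = v} isF isV eq with v ∈? F
  search-sound (suc fuel) isF isV refl | yes v∈F = Equivalence.to (isF _) v∈F
  ... | no _ = search-sound fuel (next-frontier isF isV) (next-visited isF isV) eq

  -- The bound `k ≤ d` says that the search has not yet passed `v`, and `d ≤ k + fuel` that the
  -- truncation does not cut it off. A miss at the frontier raises the first bound strictly; without
  -- fuel the two force `d ≡ k`.
  search-complete : ∀ fuel {k F V v d} → IsFrontier k F → IsVisited k V →
                    Distance R u v d → k ≤ d → d ≤ k ℕ.+ fuel → search fuel k F V v ≡ just d
  search-complete zero {k} {F} {v = v} isF isV dist k≤d d≤ with v ∈? F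
  ... | yes v∈F = cong just (Distance-unique (Equivalence.to (isF v) v∈F) dist)
  ... | no  v∉F = contradiction
    (Equivalence.from (isF v) (subst (Distance R u v) (ℕ.≤-antisym (subst (_ ≤_) (ℕ.+-identityʳ k) d≤) k≤d) dist)) v∉F
  search-complete (suc fuel) {k} {F} {v = v} {d} isF isV dist k≤d d≤ with v ∈? F
  ... | yes v∈F = cong just (Distance-unique (Equivalence.to (isF v) v∈F) dist)
  ... | no  v∉F = search-complete fuel (next-frontier isF isV) (next-visited isF isV) dist
    (ℕ.≤∧≢⇒< k≤d λ { refl → v∉F (Equivalence.from (isF v) dist) })
    (subst (d ≤_) (ℕ.+-suc k fuel) d≤)

  private
    start-frontier : IsFrontier 0 [ u ]
    start-frontier x = mk⇔ (λ { (here refl) → Distance-refl }) λ { ((ε , _) , _) → here refl }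

    start-visited : IsVisited 0 [ u ]
    start-visited x = mk⇔ (λ { (here refl) → ε , z≤n }) λ { (ε , _) → here refl }

  distance-sound : ∀ {depth v d} → distance depth u v ≡ just d → Distance R u v d
  distance-sound {depth} = search-sound depth start-frontier start-visited

  distance-complete : ∀ {depth v d} → Distance R u v d → d ≤ depth → distance depth u v ≡ just d
  distance-complete {depth} dist d≤ = search-complete depth start-frontier start-visited dist z≤n d≤

-- Homomorphisms, quotients and sums

module _ (G Q : AbelianGroup 0ℓ 0ℓ) where

  private
    module G = AbelianGroup G
    module Q = AbelianGroup Q
    module QP = AbelianGroupProperties Q

  ∙-homo⇒isGroupHomomorphism : (f : G.Carrier → Q.Carrier) → (∀ {x y} → x G.≈ y → f x Q.≈ f y) →
                        (∀ x y → f (x G.∙ y) Q.≈ f x Q.∙ f y) →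
                        IsGroupHomomorphism G.rawGroup Q.rawGroup f
  ∙-homo⇒isGroupHomomorphism f f-cong homo = record
    { isMonoidHomomorphism = record
      { isMagmaHomomorphism = record { isRelHomomorphism = record { cong = f-cong } ; homo = homo }
      ; ε-homo = ε-homo }
    ; ⁻¹-homo = λ x → QP.inverseˡ-unique _ _
        (Q.trans (Q.sym (homo _ _)) (Q.trans (f-cong (G.inverseˡ x)) ε-homo)) }
    where
    ε-homo : f G.ε Q.≈ Q.ε
    ε-homo = QP.identityˡ-unique _ _ (Q.trans (Q.sym (homo _ _)) (f-cong (G.identityˡ G.ε)))

module QuotientProperties {G Q : AbelianGroup 0ℓ 0ℓ} {H : Pred (AbelianGroup.Carrier G) 0ℓ}
                          (q : Quotient G H Q) where

  private
    module G = AbelianGroup G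
    module Q = AbelianGroup Q
    module QP = AbelianGroupProperties Q

  open Quotient q public
  open IsGroupHomomorphism isGroupHomomorphism public
  module Kernel x = Equivalence (kernel x)

  lift : Q.Carrier → G.Carrier
  lift y = proj₁ (surjective y)

  ⟦lift⟧ : ∀ y → ⟦ lift y ⟧ Q.≈ y
  ⟦lift⟧ y = proj₂ (surjective y) G.refl

  ⟦-⟧ : ∀ x y → ⟦ x G.∙ y G.⁻¹ ⟧ Q.≈ ⟦ x ⟧ Q.∙ ⟦ y ⟧ Q.⁻¹
  ⟦-⟧ x y = Q.trans (homo x (y G.⁻¹)) (Q.∙-congˡ (⁻¹-homo y))

  ⟦⟧-injective : ∀ {x y} → ⟦ x ⟧ Q.≈ ⟦ y ⟧ → H (x G.∙ y G.⁻¹)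
  ⟦⟧-injective {x} {y} eq = Kernel.to _ (Q.trans (⟦-⟧ x y) (QP.x≈y⇒x∙y⁻¹≈ε eq))

  ⟦⟧-cong-H : ∀ {x y} → H (x G.∙ y G.⁻¹) → ⟦ x ⟧ Q.≈ ⟦ y ⟧
  ⟦⟧-cong-H {x} {y} h = QP.x∙y⁻¹≈ε⇒x≈y _ _ (Q.trans (Q.sym (⟦-⟧ x y)) (Kernel.from _ h))

module _ (M : CommutativeMonoid 0ℓ 0ℓ) where

  open CommutativeMonoid M using (Carrier; _≈_; ∙-cong; ∙-congˡ; identityˡ; identityʳ; rawMonoid)
    renaming (ε to 0#; refl to ≈-refl; trans to ≈-trans)
  open Sum M using (sum-cong-≋; sum-replicate-zero)

  sum-zero : ∀ {n} (f : Fin n → Carrier) → (∀ i → f i ≈ 0#) → sum rawMonoid f ≈ 0#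
  sum-zero {n} f f≈0 = ≈-trans (sum-cong-≋ f≈0) (sum-replicate-zero n)

  sum-single : ∀ {n} (f : Fin n → Carrier) k → (∀ i → i ≢ k → f i ≈ 0#) → sum rawMonoid f ≈ f k
  sum-single f zero    off = ≈-trans (∙-congˡ (sum-zero (f ∘ suc) λ i → off (suc i) λ ())) (identityʳ _)
  sum-single f (suc k) off = ≈-trans
    (∙-cong (off zero λ ()) (sum-single (f ∘ suc) k λ i i≢k → off (suc i) (i≢k ∘ Fin.suc-injective)))
    (identityˡ _)

module ℤΣ where
  open Sum ℤ.+-0-commutativeMonoid public
  open SemiringSum ℤ.+-*-semiring public using (*-distribˡ-sum; *-distribʳ-sum)

δ-refl : ∀ {t} (j : Fin t) → δ j j ≡ 1ℤ
δ-refl j with j Fin.≟ j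
... | yes _  = refl
... | no j≢j = contradiction refl j≢j

δ-≢ : ∀ {t} {j k : Fin t} → j ≢ k → δ j k ≡ 0ℤ
δ-≢ {j = j} {k} j≢k with j Fin.≟ k
... | yes j≡k = contradiction j≡k j≢k
... | no _    = refl

module _ {c t} (A : Matrix c t) where

  combination-+ : ∀ y z j → combination (λ i → y i ℤ.+ z i) A j ≡ combination y A j ℤ.+ combination z A j
  combination-+ y z j = trans
    (ℤΣ.sum-cong-≗ λ i → ℤ.*-distribʳ-+ (A i j) (y i) (z i))
    (ℤΣ.∑-distrib-+ (λ i → y i ℤ.* A i j) (λ i → z i ℤ.* A i j))

  combination-* : ∀ s y j → combination (λ i → s ℤ.* y i) A j ≡ s ℤ.* combination y A j
  combination-* s y j = trans
    (ℤΣ.sum-cong-≗ λ i → ℤ.*-assoc s (y i) (A i j))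
    (sym (ℤΣ.*-distribˡ-sum s λ i → y i ℤ.* A i j))

  combination-δ : ∀ k j → combination (δ k) A j ≡ A k j
  combination-δ k j = trans
    (sum-single ℤ.+-0-commutativeMonoid _ k λ i i≢k → cong (ℤ._* A i j) (δ-≢ (i≢k ∘ sym)))
    (trans (cong (ℤ._* A k j) (δ-refl k)) (ℤ.*-identityˡ (A k j)))

  RowLattice-row : ∀ k → RowLattice A (A k)
  RowLattice-row k = δ k , λ j → sym (combination-δ k j)

  RowLattice-+* : ∀ {x y} s → RowLattice A x → RowLattice A y → RowLattice A (λ j → x j ℤ.+ s ℤ.* y j)
  RowLattice-+* s (a , eq) (b , eq′) = (λ i → a i ℤ.+ s ℤ.* b i) , λ j → sym (begin
    combination (λ i → a i ℤ.+ s ℤ.* b i) A j                   ≡⟨ combination-+ a (λ i → s ℤ.* b i) j ⟩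
    combination a A j ℤ.+ combination (λ i → s ℤ.* b i) A j     ≡⟨ cong₂ ℤ._+_ (sym (eq j)) (trans (combination-* s b j) (cong (s ℤ.*_) (sym (eq′ j)))) ⟩
    _                                                           ∎)
    where open ≡-Reasoning

  RowLattice-cong : ∀ {x y} → (∀ j → x j ≡ y j) → RowLattice A x → RowLattice A y
  RowLattice-cong x≗y (a , eq) = a , λ j → trans (sym (x≗y j)) (eq j)

∣-combination : ∀ {c t} {A : Matrix c t} {d} j → (∀ k → d ℤ∣.∣ A k j) → ∀ y → d ℤ∣.∣ combination y A j
∣-combination {zero}  j d∣A y = divides 0ℤ refl
∣-combination {suc c} {A = A} j d∣A y =
  ℤ∣.∣m∣n⇒∣m+n (ℤ∣.∣n⇒∣m*n (y zero) (d∣A zero)) (∣-combination {A = A ∘ suc} j (d∣A ∘ suc) (y ∘ suc))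

-- Residues of integers modulo N

module Reduction (N : ℕ) (nz : NonZero N) where

  private
    instance
      N≢0 : NonZero N
      N≢0 = nz

  open AbelianGroup (ℤ/ N) using (_∙_) renaming (ε to 0#)

  residue : ℤ → Fin N
  residue x = Fin.fromℕ< (ℤ.n%ℕd<d x N)

  residue-∣ : ∀ x → + N ℤ∣.∣ x ℤ.- + toℕ (residue x)
  residue-∣ x = divides (x ℤ./ℕ N) (begin
    x ℤ.- + toℕ (residue x)                               ≡⟨ cong₂ (λ a b → a ℤ.- + b) (ℤ.a≡a%ℕn+[a/ℕn]*n x N) (Fin.toℕ-fromℕ< _) ⟩
    + (x ℤ.%ℕ N) ℤ.+ (x ℤ./ℕ N) ℤ.* + N ℤ.- + (x ℤ.%ℕ N)  ≡⟨ cancel (+ (x ℤ.%ℕ N)) _ ⟩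
    (x ℤ./ℕ N) ℤ.* + N                                    ∎)
    where
    open ≡-Reasoning
    cancel : ∀ a b → a ℤ.+ b ℤ.- a ≡ b
    cancel = solve-∀

  -- The difference of two representatives has absolute value below `N`, and the only such multiple
  -- of `N` is zero.
  representative-unique : ∀ {a b : Fin N} → + N ℤ∣.∣ + toℕ a ℤ.- + toℕ b → a ≡ b
  representative-unique {a} {b} N∣ = Fin.toℕ-injective (ℤ.+-injective (ℤ.i-j≡0⇒i≡j _ _ (ℤ.∣i∣≡0⇒i≡0 small)))
    where
    bound : ∣ + toℕ a ℤ.- + toℕ b ∣ ℕ.< N
    bound = ℕ.≤-<-trans
      (subst (λ z → ∣ z ∣ ≤ toℕ a ℕ.⊔ toℕ b) (sym (ℤ.m-n≡m⊖n (toℕ a) (toℕ b))) (ℤ.∣m⊝n∣≤m⊔n (toℕ a) (toℕ b)))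
      (ℕ.⊔-lub (Fin.toℕ<n a) (Fin.toℕ<n b))
    small : ∣ + toℕ a ℤ.- + toℕ b ∣ ≡ 0
    small with ∣ + toℕ a ℤ.- + toℕ b ∣ | bound | ℤ∣.∣⇒∣ᵤ N∣
    ... | zero  | _  | _   = refl
    ... | suc _ | lt | N∣d = contradiction N∣d (ℕ∣.>⇒∤ lt)

  -- This characterisation by divisibility turns the identities for `residue` below into statements
  -- about integer multiples of `N`.
  residue-unique : ∀ {a : Fin N} x → + N ℤ∣.∣ x ℤ.- + toℕ a → residue x ≡ a
  residue-unique {a} x N∣ = representative-unique
    (subst (+ N ℤ∣.∣_) (shift x (+ toℕ a) (+ toℕ (residue x))) (ℤ∣.∣m∣n⇒∣m-n N∣ (residue-∣ x)))
    where
    shift : ∀ x a b → (x ℤ.- a) ℤ.- (x ℤ.- b) ≡ b ℤ.- a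
    shift = solve-∀

  residue-toℕ : ∀ a → residue (+ toℕ a) ≡ a
  residue-toℕ a = residue-unique (+ toℕ a) (divides 0ℤ (ℤ.+-inverseʳ (+ toℕ a)))

  residue-homo : ∀ x y → residue (x ℤ.+ y) ≡ residue x ∙ residue y
  residue-homo x y = residue-unique (x ℤ.+ y)
    (subst (+ N ℤ∣.∣_) (shift x y (+ a) (+ b) (+ toℕ (residue x ∙ residue y)))
      (ℤ∣.∣m∣n⇒∣m+n (ℤ∣.∣m∣n⇒∣m+n (residue-∣ x) (residue-∣ y)) (divides (+ ((a ℕ.+ b) ℕ./ N)) (begin
        + a ℤ.+ + b ℤ.- + toℕ (residue x ∙ residue y)   ≡⟨ cong₂ (λ u v → + u ℤ.- + v) (ℕ.m≡m%n+[m/n]*n (a ℕ.+ b) N) (Modular.toℕ-mod N (a ℕ.+ b)) ⟩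
        + (r ℕ.+ k) ℤ.- + r                             ≡⟨ cancel (+ r) (+ k) ⟩
        + k                                             ≡⟨ ℤ.pos-* ((a ℕ.+ b) ℕ./ N) N ⟩
        + ((a ℕ.+ b) ℕ./ N) ℤ.* + N                     ∎))))
    where
    open ≡-Reasoning
    a = toℕ (residue x)
    b = toℕ (residue y)
    r = (a ℕ.+ b) ℕ.% N
    k = (a ℕ.+ b) ℕ./ N ℕ.* N
    cancel : ∀ a b → a ℤ.+ b ℤ.- a ≡ b
    cancel = solve-∀
    shift : ∀ x y a b c → (x ℤ.- a) ℤ.+ (y ℤ.- b) ℤ.+ (a ℤ.+ b ℤ.- c) ≡ x ℤ.+ y ℤ.- c
    shift = solve-∀

  residue-0 : ∀ {x} → + N ℤ∣.∣ x → residue x ≡ 0#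
  residue-0 {x} N∣x = residue-unique x (subst (+ N ℤ∣.∣_) eq N∣x)
    where
    eq : x ≡ x ℤ.- + toℕ 0#
    eq = trans (sym (ℤ.+-identityʳ x))
      (cong (λ k → x ℤ.- + k) (sym (trans (Fin.toℕ-fromℕ< _) (ℕ.m<n⇒m%n≡m (ℕ.>-nonZero⁻¹ N)))))

  residue-0⁻¹ : ∀ {x} → residue x ≡ 0# → + N ℤ∣.∣ x
  residue-0⁻¹ {x} eq = subst (+ N ℤ∣.∣_) eq′ (residue-∣ x)
    where
    eq′ : x ℤ.- + toℕ (residue x) ≡ x
    eq′ = trans
      (cong (λ k → x ℤ.- + k) (trans (cong toℕ eq) (trans (Fin.toℕ-fromℕ< _) (ℕ.m<n⇒m%n≡m (ℕ.>-nonZero⁻¹ N)))))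
      (ℤ.+-identityʳ x)

module _ where

  open Product

  add-++⁺ : ∀ {Ms Ns} (mzs : All NonZero Ms) (nzs : All NonZero Ns) a b c d →
            add (All.++⁺ mzs nzs) (All.++⁺ a b) (All.++⁺ c d) ≡ All.++⁺ (add mzs a c) (add nzs b d)
  add-++⁺ []        nzs []      b []      d = refl
  add-++⁺ (_ ∷ mzs) nzs (_ ∷ a) b (_ ∷ c) d = cong (_ ∷_) (add-++⁺ mzs nzs a b c d)

  zeros-++⁺ : ∀ {Ms Ns} (mzs : All NonZero Ms) (nzs : All NonZero Ns) →
              All.++⁺ (zeros mzs) (zeros nzs) ≡ zeros (All.++⁺ mzs nzs)
  zeros-++⁺ []        nzs = refl
  zeros-++⁺ (_ ∷ mzs) nzs = cong (_ ∷_) (zeros-++⁺ mzs nzs)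

∷-injective : ∀ {A : Set} {P : A → Set} {z zs} {x y : P z} {u v : All P zs} →
              x All.∷ u ≡ y ∷ v → x ≡ y × u ≡ v
∷-injective refl = refl , refl

++⁺-injective : ∀ {A : Set} {P : A → Set} {xs ys} (a c : All P xs) {b d : All P ys} →
                All.++⁺ a b ≡ All.++⁺ c d → a ≡ c × b ≡ d
++⁺-injective []      []      refl = refl , refl
++⁺-injective (x ∷ a) (y ∷ c) eq with ∷-injective eq
... | refl , eq′ with ++⁺-injective a c eq′
...   | refl , eq″ = refl , eq″

-- Smith normal form

-- Indexed by the lattice and not by a matrix, so that row operations change nothing and only column
-- operations need an argument. The field `common-divisor` strengthens the induction: a pivot
-- dividing the whole lattice then divides all later invariants, which is the first link of the
-- divisibility chain.
record SmithForm {t} (Λ : Pred (Fin t → ℤ) 0ℓ) : Set where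
  field
    invariants     : List ℕ
    nonZero        : All NonZero invariants
    divisible      : Linked ℕ∣._∣_ invariants
    rank           : ℕ
    quotient       : Quotient (ℤ^ t) Λ (∏ℤ/ invariants nonZero ⊞ ℤ^ rank)
    common-divisor : ∀ {d} → (∀ {x} → Λ x → ∀ j → + d ℤ∣.∣ x j) → All (d ℕ∣.∣_) invariants

smithForm-0 : ∀ {c t} (A : Matrix c t) → (∀ i j → A i j ≡ 0ℤ) → SmithForm (RowLattice A)
smithForm-0 {t = t} A A≡0 = record
  { invariants = [] ; nonZero = [] ; divisible = [] ; rank = t
  ; quotient = record
    { ⟦_⟧ = λ x → [] , x
    ; isGroupHomomorphism = ∙-homo⇒isGroupHomomorphism (ℤ^ t) (∏ℤ/ [] [] ⊞ ℤ^ t) (λ x → [] , x)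
        (λ x≗y → refl , x≗y) (λ x y → refl , λ _ → refl)
    ; surjective = λ { ([] , y) → y , λ z≗y → refl , z≗y }
    ; kernel = λ x → mk⇔
        (λ { (_ , x≡0) → (λ _ → 0ℤ) , λ j → trans (x≡0 j)
             (sym (sum-zero ℤ.+-0-commutativeMonoid (λ i → 0ℤ ℤ.* A i j) λ _ → refl)) })
        (λ { (y , eq) → refl , λ j → trans (eq j)
             (sum-zero ℤ.+-0-commutativeMonoid (λ i → y i ℤ.* A i j)
               λ i → trans (cong (y i ℤ.*_) (A≡0 i j)) (ℤ.*-zeroʳ (y i))) }) }
  ; common-divisor = λ _ → [] }

-- Elementary column operations with common source column `j`, done simultaneously. If `s j` is
-- zero, coordinate `j` is preserved and the negated coefficients undo the operation.
shear : ∀ {t} → (Fin t → ℤ) → Fin t → (Fin t → ℤ) → Fin t → ℤ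
shear s j v m = v m ℤ.+ s m ℤ.* v j

module _ {t} {j : Fin t} where

  shear-cong : ∀ s {v w : Fin t → ℤ} → (∀ m → v m ≡ w m) → ∀ m → shear s j v m ≡ shear s j w m
  shear-cong s v≗w m = cong₂ (λ a b → a ℤ.+ s m ℤ.* b) (v≗w m) (v≗w j)

  shear-+ : ∀ s v w m → shear s j (λ l → v l ℤ.+ w l) m ≡ shear s j v m ℤ.+ shear s j w m
  shear-+ s v w m = expand (v m) (w m) (s m) (v j) (w j)
    where
    expand : ∀ a b s c d → a ℤ.+ b ℤ.+ s ℤ.* (c ℤ.+ d) ≡ a ℤ.+ s ℤ.* c ℤ.+ (b ℤ.+ s ℤ.* d)
    expand = solve-∀

  shear-inverse : ∀ s r → s j ≡ 0ℤ → (∀ m → r m ≡ ℤ.- s m) →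
                  ∀ (v : Fin t → ℤ) m → shear r j (shear s j v) m ≡ v m
  shear-inverse s r sj≡0 r≡-s v m = trans
    (cong₂ (λ a b → v m ℤ.+ s m ℤ.* v j ℤ.+ a ℤ.* (v j ℤ.+ b ℤ.* v j)) (r≡-s m) sj≡0)
    (cancel (v m) (s m) (v j))
    where
    cancel : ∀ a s b → a ℤ.+ s ℤ.* b ℤ.+ ℤ.- s ℤ.* (b ℤ.+ 0ℤ ℤ.* b) ≡ a
    cancel = solve-∀

  combination-shear : ∀ {c} s (A : Matrix c t) y m →
                      combination y (shear s j ∘ A) m ≡ shear s j (combination y A) m
  combination-shear s A y m = begin
    combination y (shear s j ∘ A) m                              ≡⟨ ℤΣ.sum-cong-≗ (λ i → expand (y i) (A i m) (s m) (A i j)) ⟩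
    ℤΣ.sum (λ i → y i ℤ.* A i m ℤ.+ s m ℤ.* (y i ℤ.* A i j))      ≡⟨ ℤΣ.∑-distrib-+ (λ i → y i ℤ.* A i m) (λ i → s m ℤ.* (y i ℤ.* A i j)) ⟩
    combination y A m ℤ.+ ℤΣ.sum (λ i → s m ℤ.* (y i ℤ.* A i j))  ≡⟨ cong (λ z → combination y A m ℤ.+ z) (ℤΣ.*-distribˡ-sum (s m) (λ i → y i ℤ.* A i j)) ⟨
    shear s j (combination y A) m                                ∎
    where
    open ≡-Reasoning
    expand : ∀ y a s b → y ℤ.* (a ℤ.+ s ℤ.* b) ≡ y ℤ.* a ℤ.+ s ℤ.* (y ℤ.* b)
    expand = solve-∀

  module _ {c} (s : Fin t → ℤ) (sj≡0 : s j ≡ 0ℤ) (A : Matrix c t) where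

    private
      s⁻ : Fin t → ℤ
      s⁻ m = ℤ.- s m

    RowLattice-shear : ∀ {x} → RowLattice A x → RowLattice (shear s j ∘ A) (shear s j x)
    RowLattice-shear (y , eq) = y , λ m → trans (shear-cong s eq m) (sym (combination-shear s A y m))

    RowLattice-shear⁻¹ : ∀ {x} → RowLattice (shear s j ∘ A) (shear s j x) → RowLattice A x
    RowLattice-shear⁻¹ {x} (y , eq) = y , λ m → begin
      x m                                             ≡⟨ shear-inverse s s⁻ sj≡0 (λ _ → refl) x m ⟨
      shear s⁻ j (shear s j x) m                      ≡⟨ shear-cong s⁻ (λ l → trans (eq l) (combination-shear s A y l)) m ⟩
      shear s⁻ j (shear s j (combination y A)) m      ≡⟨ shear-inverse s s⁻ sj≡0 (λ _ → refl) (combination y A) m ⟩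
      combination y A m                               ∎
      where open ≡-Reasoning

    -- A shear is an automorphism of `ℤ^ t` that carries one lattice onto the other, so precomposing
    -- the quotient map with it suffices. It also preserves common divisors of the entries, so the
    -- invariants remain as they are.
    smithForm-shear : SmithForm (RowLattice (shear s j ∘ A)) → SmithForm (RowLattice A)
    smithForm-shear S = record
      { invariants = S.invariants ; nonZero = S.nonZero ; divisible = S.divisible ; rank = S.rank
      ; quotient = record
        { ⟦_⟧ = λ x → Q.⟦ shear s j x ⟧
        ; isGroupHomomorphism = ∙-homo⇒isGroupHomomorphism (ℤ^ t) Γ (λ x → Q.⟦ shear s j x ⟧)
            (λ x≗y → Q.⟦⟧-cong (shear-cong s x≗y))
            (λ x y → Γ.trans (Q.⟦⟧-cong (shear-+ s x y)) (Q.homo (shear s j x) (shear s j y)))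
        ; surjective = λ y → shear s⁻ j (Q.lift y) , λ {z} z≗ → Γ.trans
            (Q.⟦⟧-cong λ m → trans (shear-cong s z≗ m) (shear-inverse s⁻ s s⁻j≡0 (λ l → sym (ℤ.neg-involutive (s l))) (Q.lift y) m))
            (Q.⟦lift⟧ y)
        ; kernel = λ x → mk⇔ (RowLattice-shear⁻¹ ∘ Q.Kernel.to _) (Q.Kernel.from _ ∘ RowLattice-shear) }
      ; common-divisor = λ {d} d∣Λ → S.common-divisor λ { (y , eq) m →
          subst (+ d ℤ∣.∣_) (sym (trans (eq m) (combination-shear s A y m)))
            (ℤ∣.∣m∣n⇒∣m+n (d∣Λ (y , λ _ → refl) m) (ℤ∣.∣n⇒∣m*n (s m) (d∣Λ (y , λ _ → refl) j))) } }
      where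
      module S = SmithForm S
      Γ = ∏ℤ/ S.invariants S.nonZero ⊞ ℤ^ S.rank
      module Γ = AbelianGroup Γ
      module Q = QuotientProperties S.quotient
      s⁻j≡0 : s⁻ j ≡ 0ℤ
      s⁻j≡0 = cong ℤ.-_ sj≡0

-- Here v = p eⱼ, and p divides the column j, so subtracting multiples of v from
-- the rows splits the lattice into ℤ v and its projection off the coordinate j.
module Split {c t} (A : Matrix c (suc t)) (j : Fin (suc t)) (v : Fin (suc t) → ℤ) (v∈ : RowLattice A v)
             (vj≢0 : v j ≢ 0ℤ) (v-off : ∀ l → v (Fin.punchIn j l) ≡ 0ℤ) (p∣A : ∀ k l → v j ℤ∣.∣ A k l)
             (S : SmithForm (RowLattice (λ k → Vector.removeAt (A k) j))) where

  private
    module S = SmithForm S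
    module Q = QuotientProperties S.quotient

    A′ : Matrix c t
    A′ k = Vector.removeAt (A k) j

    p : ℤ
    p = v j

    N : ℕ
    N = ∣ p ∣

    N≢0 : NonZero N
    N≢0 = ℕ.≢-nonZero (vj≢0 ∘ ℤ.∣i∣≡0⇒i≡0)

    module N = Reduction N N≢0

    b : Fin c → ℤ
    b k = ℤ∣.quotient (p∣A k j)

    p∣Λ : ∀ {x} → RowLattice A x → ∀ l → p ℤ∣.∣ x l
    p∣Λ (y , eq) l = subst (p ℤ∣.∣_) (sym (eq l)) (∣-combination {A = A} l (λ k → p∣A k l) y)

    Γ′ Γ : AbelianGroup 0ℓ 0ℓ
    Γ′ = ∏ℤ/ S.invariants S.nonZero ⊞ ℤ^ S.rank
    Γ  = ∏ℤ/ (N ∷ S.invariants) (N≢0 ∷ S.nonZero) ⊞ ℤ^ S.rank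

    module Γ′ = AbelianGroup Γ′

    ⟦_⟧ : (Fin (suc t) → ℤ) → AbelianGroup.Carrier Γ
    ⟦ x ⟧ = (N.residue (x j) ∷ proj₁ Q.⟦ Vector.removeAt x j ⟧) , proj₂ Q.⟦ Vector.removeAt x j ⟧

    -- The combination given by `y` agrees with `x` off `j`. At `j` it equals `σ * p` while `x` has
    -- `s * p`; adding `s - σ` copies of `v`, which vanishes off `j`, repairs this coordinate alone.
    kernel⇒Λ : ∀ {x} → + N ℤ∣.∣ x j → RowLattice A′ (Vector.removeAt x j) → RowLattice A x
    kernel⇒Λ {x} N∣xj (y , eq) with ℤ∣.∣-trans ℤ∣.m∣∣m∣ N∣xj
    ... | divides s xj≡ = RowLattice-cong A x≗ (RowLattice-+* A (s ℤ.- σ) (y , λ _ → refl) v∈)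
      where
      σ = ℤΣ.sum (λ k → y k ℤ.* b k)
      column : combination y A j ≡ σ ℤ.* p
      column = trans
        (ℤΣ.sum-cong-≗ λ k → trans (cong (y k ℤ.*_) (ℤ∣._∣_.equality (p∣A k j))) (sym (ℤ.*-assoc (y k) (b k) p)))
        (sym (ℤΣ.*-distribʳ-sum p (λ k → y k ℤ.* b k)))
      at-j : combination y A j ℤ.+ (s ℤ.- σ) ℤ.* v j ≡ x j
      at-j = trans (cong (ℤ._+ (s ℤ.- σ) ℤ.* p) column) (trans (cancel σ s p) (sym xj≡))
        where
        cancel : ∀ σ s p → σ ℤ.* p ℤ.+ (s ℤ.- σ) ℤ.* p ≡ s ℤ.* p
        cancel = solve-∀
      off-j : ∀ l → combination y A (Fin.punchIn j l) ℤ.+ (s ℤ.- σ) ℤ.* v (Fin.punchIn j l) ≡ x (Fin.punchIn j l)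
      off-j l = begin
        combination y A (Fin.punchIn j l) ℤ.+ (s ℤ.- σ) ℤ.* v (Fin.punchIn j l)  ≡⟨ cong (λ z → combination y A (Fin.punchIn j l) ℤ.+ (s ℤ.- σ) ℤ.* z) (v-off l) ⟩
        combination y A (Fin.punchIn j l) ℤ.+ (s ℤ.- σ) ℤ.* 0ℤ                    ≡⟨ cong₂ ℤ._+_ (sym (eq l)) (ℤ.*-zeroʳ (s ℤ.- σ)) ⟩
        x (Fin.punchIn j l) ℤ.+ 0ℤ                                               ≡⟨ ℤ.+-identityʳ _ ⟩
        x (Fin.punchIn j l)                                                      ∎
        where open ≡-Reasoning
      x≗ : ∀ m → combination y A m ℤ.+ (s ℤ.- σ) ℤ.* v m ≡ x m
      x≗ m with j Fin.≟ m
      ... | yes refl = at-j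
      ... | no j≢m   = subst (λ m → combination y A m ℤ.+ (s ℤ.- σ) ℤ.* v m ≡ x m)
                         (Fin.punchIn-punchOut j≢m) (off-j (Fin.punchOut j≢m))

    N∣p : + N ℤ∣.∣ p
    N∣p = ℤ∣.∣m∣∣m

    kernel : ∀ x → AbelianGroup._≈_ Γ ⟦ x ⟧ (AbelianGroup.ε Γ) ⇔ RowLattice A x
    kernel x = mk⇔
      (λ { (eq , eq′) → kernel⇒Λ (N.residue-0⁻¹ (proj₁ (∷-injective eq))) (Q.Kernel.to _ (proj₂ (∷-injective eq) , eq′)) })
      (λ x∈ → let (eq , eq′) = Q.Kernel.from _ (proj₁ x∈ , λ l → proj₂ x∈ (Fin.punchIn j l))
              in cong₂ _∷_ (N.residue-0 (ℤ∣.∣-trans N∣p (p∣Λ x∈ j))) eq , eq′)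

  smithForm : SmithForm (RowLattice A)
  smithForm = record
    { invariants = N ∷ S.invariants ; nonZero = N≢0 ∷ S.nonZero
    ; divisible = linked (S.common-divisor λ { (y , eq) l →
        ℤ∣.∣-trans N∣p (subst (p ℤ∣.∣_) (sym (eq l)) (p∣Λ (y , λ _ → refl) (Fin.punchIn j l))) }) S.divisible
    ; rank = S.rank
    ; quotient = record
      { ⟦_⟧ = ⟦_⟧
      ; isGroupHomomorphism = ∙-homo⇒isGroupHomomorphism (ℤ^ (suc t)) Γ ⟦_⟧
          (λ x≗y → let (eq , eq′) = Q.⟦⟧-cong (x≗y ∘ Fin.punchIn j)
                   in cong₂ _∷_ (cong N.residue (x≗y j)) eq , eq′)
          (λ x y → let (eq , eq′) = Q.homo (Vector.removeAt x j) (Vector.removeAt y j)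
                   in cong₂ _∷_ (N.residue-homo (x j) (y j)) eq , eq′)
      ; surjective = λ { (a ∷ as , w) → Vector.insertAt (Q.lift (as , w)) j (+ toℕ a) , λ {z} z≗ →
          let (eq , eq′) = Γ′.trans
                (Q.⟦⟧-cong λ l → trans (z≗ (Fin.punchIn j l)) (Vector.insertAt-punchIn (Q.lift (as , w)) j (+ toℕ a) l))
                (Q.⟦lift⟧ (as , w))
          in cong₂ _∷_ (trans (cong N.residue (trans (z≗ j) (Vector.insertAt-lookup (Q.lift (as , w)) j (+ toℕ a)))) (N.residue-toℕ a)) eq , eq′ }
      ; kernel = kernel }
    -- The vector `v` itself lies in the lattice, so `d` divides `v j` and hence the new invariant
    -- `N`.
    ; common-divisor = λ {d} d∣Λ → ℤ∣.∣⇒∣ᵤ (d∣Λ v∈ j) ∷ S.common-divisor λ { (y , eq) l →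
        subst (+ d ℤ∣.∣_) (sym (eq l)) (d∣Λ (y , λ _ → refl) (Fin.punchIn j l)) } }
    where
    linked : ∀ {m ms} → All (m ℕ∣.∣_) ms → Linked ℕ∣._∣_ ms → Linked ℕ∣._∣_ (m ∷ ms)
    linked []      _   = [-]
    linked (d ∷ _) lnk = d ∷ lnk

-- One step of Euclid's algorithm: the quotient is negated so that the sum is the remainder. Its
-- smaller absolute value drives the recursion in `pivot`, and its being nonzero lets it serve as
-- the next pivot.
remainder : ∀ p x → p ≢ 0ℤ → ¬ p ℤ∣.∣ x → ∃[ q ] ∣ x ℤ.+ q ℤ.* p ∣ ℕ.< ∣ p ∣ × x ℤ.+ q ℤ.* p ≢ 0ℤ
remainder p x p≢0 p∤x = ℤ.- (x ℤ./ p) , small , nonzero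
  where
  instance
    p-nonZero : ℤ.NonZero p
    p-nonZero = ℤ.≢-nonZero p≢0
  cancel : ∀ r q p → r ℤ.+ q ℤ.* p ℤ.+ ℤ.- q ℤ.* p ≡ r
  cancel = solve-∀
  eq : x ℤ.+ ℤ.- (x ℤ./ p) ℤ.* p ≡ + (x ℤ.% p)
  eq = trans (cong (λ z → z ℤ.+ ℤ.- (x ℤ./ p) ℤ.* p) (ℤ.a≡a%n+[a/n]*n x p)) (cancel (+ (x ℤ.% p)) (x ℤ./ p) p)
  small : ∣ x ℤ.+ ℤ.- (x ℤ./ p) ℤ.* p ∣ ℕ.< ∣ p ∣
  small = subst (λ z → ∣ z ∣ ℕ.< ∣ p ∣) (sym eq) (ℤ.n%d<d x p)
  nonzero : x ℤ.+ ℤ.- (x ℤ./ p) ℤ.* p ≢ 0ℤ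
  nonzero r≡0 = p∤x (divides (x ℤ./ p) (ℤ.i-j≡0⇒i≡j _ _ (trans (move x (x ℤ./ p) p) r≡0)))
    where
    move : ∀ x q p → x ℤ.- q ℤ.* p ≡ x ℤ.+ ℤ.- q ℤ.* p
    move = solve-∀

-- Every lattice vector v with v j ≢ 0 serves as a pivot: as long as v j fails
-- to divide some entry of A, a smaller pivot exists, up to shearing columns.
pivot : ∀ {t} → (∀ {c} (A : Matrix c t) → SmithForm (RowLattice A)) →
        ∀ {c} (A : Matrix c (suc t)) v → RowLattice A v → ∀ j → v j ≢ 0ℤ → Acc ℕ._<_ ∣ v j ∣ →
        SmithForm (RowLattice A)
pivot {t} smith {c} A v v∈ j p≢0 (acc rs) = go
  where
  p = v j

  -- Adding `q` times column `j` to column `l` replaces `w l` by its remainder modulo `p`, because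
  -- `w` has exactly `p` at `j`. The pivot then moves to column `l` with a smaller absolute value.
  shear-away : ∀ w → RowLattice A w → w j ≡ p → ∀ l → ¬ p ℤ∣.∣ w l → SmithForm (RowLattice A)
  shear-away w w∈ wj≡p l p∤wl with remainder p (w l) p≢0 p∤wl
  ... | q , small , nonzero = smithForm-shear s sj≡0 A
    (pivot smith (shear s j ∘ A) (shear s j w) (RowLattice-shear s sj≡0 A w∈) l
      (nonzero ∘ trans (sym wl≡)) (rs (subst (λ z → ∣ z ∣ ℕ.< ∣ p ∣) (sym wl≡) small)))
    where
    l≢j : l ≢ j
    l≢j refl = p∤wl (divides 1ℤ (trans wj≡p (sym (ℤ.*-identityˡ p))))
    s : Fin (suc t) → ℤ
    s m = q ℤ.* δ l m
    sj≡0 : s j ≡ 0ℤ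
    sj≡0 = trans (cong (q ℤ.*_) (δ-≢ l≢j)) (ℤ.*-zeroʳ q)
    wl≡ : shear s j w l ≡ w l ℤ.+ q ℤ.* p
    wl≡ = cong₂ (λ a b → w l ℤ.+ a ℤ.* b) (trans (cong (q ℤ.*_) (δ-refl l)) (ℤ.*-identityʳ q)) wj≡p

  clear : (∀ k l → p ℤ∣.∣ A k l) → SmithForm (RowLattice A)
  clear p∣A = smithForm-shear s sj≡0 A (Split.smithForm (shear s j ∘ A) j (shear s j v)
    (RowLattice-shear s sj≡0 A v∈) (p≢0 ∘ trans (sym vj≡)) off
    (λ k l → subst (ℤ∣._∣ shear s j (A k) l) (sym vj≡) (ℤ∣.∣m∣n⇒∣m+n (p∣A k l) (ℤ∣.∣n⇒∣m*n (s l) (p∣A k j))))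
    (smith _))
    where
    p∣v : ∀ l → p ℤ∣.∣ v l
    p∣v l = subst (p ℤ∣.∣_) (sym (proj₂ v∈ l)) (∣-combination {A = A} l (λ k → p∣A k l) (proj₁ v∈))
    s : Fin (suc t) → ℤ
    -- The first factor is 0 at `j` and -1 elsewhere: column `j` stays fixed while every other entry
    -- of `v`, a multiple of `p`, is cancelled.
    s m = (δ j m ℤ.- 1ℤ) ℤ.* ℤ∣.quotient (p∣v m)
    sj≡0 : s j ≡ 0ℤ
    sj≡0 = cong (λ z → (z ℤ.- 1ℤ) ℤ.* ℤ∣.quotient (p∣v j)) (δ-refl j)
    vj≡ : shear s j v j ≡ p
    vj≡ = trans (cong (λ z → p ℤ.+ z ℤ.* p) sj≡0) (ℤ.+-identityʳ p)
    off : ∀ l → shear s j v (Fin.punchIn j l) ≡ 0ℤ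
    off l = trans
      (cong₂ (λ a b → a ℤ.+ (b ℤ.- 1ℤ) ℤ.* a′ ℤ.* p) (ℤ∣._∣_.equality (p∣v (Fin.punchIn j l))) (δ-≢ (Fin.punchInᵢ≢i j l ∘ sym)))
      (cancel a′ p)
      where
      a′ = ℤ∣.quotient (p∣v (Fin.punchIn j l))
      cancel : ∀ a p → a ℤ.* p ℤ.+ (0ℤ ℤ.- 1ℤ) ℤ.* a ℤ.* p ≡ 0ℤ
      cancel = solve-∀

  go : SmithForm (RowLattice A)
  go with Fin.any? (λ k → ¬? (p ℤ∣.∣? A k j))
  ... | yes (k , p∤) with remainder p (A k j) p≢0 p∤
  ...   | q , small , nonzero = pivot smith A (λ m → A k m ℤ.+ q ℤ.* v m)
            (RowLattice-+* A q (RowLattice-row A k) v∈) j nonzero (rs small)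
  go | no ¬col with Fin.any? (λ l → ¬? (p ℤ∣.∣? v l))
  ... | yes (l , p∤) = shear-away v v∈ refl l p∤
  ... | no ¬row with Fin.any? (λ k → Fin.any? λ l → ¬? (p ℤ∣.∣? A k l))
  ...   | no ∤ = clear λ k l → decidable-stable (p ℤ∣.∣? A k l) λ p∤ → ∤ (k , l , p∤)
  ...   | yes (k , l , p∤) = shear-away w w∈ wj≡p l p∤w
    where
    p∣A : p ℤ∣.∣ A k j
    p∣A = decidable-stable (p ℤ∣.∣? A k j) λ p∤ → ¬col (k , p∤)
    p∣v : p ℤ∣.∣ v l
    p∣v = decidable-stable (p ℤ∣.∣? v l) λ p∤ → ¬row (l , p∤)
    b = ℤ∣.quotient p∣A
    w : Fin (suc t) → ℤ
    -- At `j` the row has `b * p`, so `1 - b` copies of `v` bring this entry to `p`. At `l` they add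
    -- a multiple of `p`, so `p` still fails to divide the entry there.
    w m = A k m ℤ.+ (1ℤ ℤ.- b) ℤ.* v m
    w∈ : RowLattice A w
    w∈ = RowLattice-+* A (1ℤ ℤ.- b) (RowLattice-row A k) v∈
    wj≡p : w j ≡ p
    wj≡p = trans (cong (ℤ._+ (1ℤ ℤ.- b) ℤ.* p) (ℤ∣._∣_.equality p∣A)) (cancel b p)
      where
      cancel : ∀ b p → b ℤ.* p ℤ.+ (1ℤ ℤ.- b) ℤ.* p ≡ p
      cancel = solve-∀
    p∤w : ¬ p ℤ∣.∣ w l
    p∤w p∣w = p∤ (ℤ∣.∣m+n∣n⇒∣m p∣w (ℤ∣.∣n⇒∣m*n (1ℤ ℤ.- b) p∣v))

smithForm : ∀ {t c} (A : Matrix c t) → SmithForm (RowLattice A)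
smithForm {zero}  A = smithForm-0 A λ _ ()
smithForm {suc t} A with Fin.any? (λ i → Fin.any? λ j → ¬? (A i j ℤ.≟ 0ℤ))
... | yes (i , j , Aij≢0) = pivot smithForm A (A i) (RowLattice-row A i) j Aij≢0 (<-wellFounded _)
... | no all≡0 = smithForm-0 A λ i j → decidable-stable (A i j ℤ.≟ 0ℤ) λ ≢0 → all≡0 (i , j , ≢0)

-- The exponent is the product of the diagonal. Taking `N * x zero` copies of the first row settles
-- the first coordinate; what remains is `N` times the vector `z x`, which lies in the lattice of
-- the lower block by induction.
torsion : ∀ {f} (H : HNF f) → ∃[ N ] N ≢ 0 × (∀ x → RowLattice (matrix H) (λ j → + N ℤ.* x j))
torsion []          = 1 , (λ ()) , λ x → (λ ()) , λ ()
torsion (row a {{a≢0}} H b) with torsion H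
... | N , N≢0 , N∈ = a ℕ.* N , aN≢0 , λ x → coefficients x , correct x
  where
  aN≢0 : a ℕ.* N ≢ 0
  aN≢0 eq with ℕ.m*n≡0⇒m≡0∨n≡0 a eq
  ... | inj₁ a≡0 = ℕ.≢-nonZero⁻¹ a a≡0
  ... | inj₂ N≡0 = N≢0 N≡0

  z : (Fin _ → ℤ) → Fin _ → ℤ
  z x j = + a ℤ.* x (suc j) ℤ.- x zero ℤ.* + toℕ (VecAll.lookup⁺ b j)

  coefficients : (Fin _ → ℤ) → Fin _ → ℤ
  coefficients x zero    = + N ℤ.* x zero
  coefficients x (suc i) = proj₁ (N∈ (z x)) i

  correct : ∀ x j → + (a ℕ.* N) ℤ.* x j ≡ combination (coefficients x) (matrix (row a H b)) j
  correct x zero = begin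
    + (a ℕ.* N) ℤ.* x zero                ≡⟨ cong (ℤ._* x zero) (ℤ.pos-* a N) ⟩
    + a ℤ.* + N ℤ.* x zero                ≡⟨ swap (+ a) (+ N) (x zero) ⟩
    + N ℤ.* x zero ℤ.* + a ℤ.+ 0ℤ         ≡⟨ cong (λ s → + N ℤ.* x zero ℤ.* + a ℤ.+ s) (sum-zero ℤ.+-0-commutativeMonoid _ λ i → ℤ.*-zeroʳ (proj₁ (N∈ (z x)) i)) ⟨
    _                                     ∎
    where
    open ≡-Reasoning
    swap : ∀ a N x → a ℤ.* N ℤ.* x ≡ N ℤ.* x ℤ.* a ℤ.+ 0ℤ
    swap = solve-∀
  correct x (suc j) = begin
    + (a ℕ.* N) ℤ.* x (suc j)                      ≡⟨ cong (ℤ._* x (suc j)) (ℤ.pos-* a N) ⟩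
    + a ℤ.* + N ℤ.* x (suc j)                      ≡⟨ split (+ a) (+ N) (x (suc j)) (x zero) (+ toℕ (VecAll.lookup⁺ b j)) ⟩
    + N ℤ.* x zero ℤ.* + toℕ (VecAll.lookup⁺ b j) ℤ.+ + N ℤ.* z x j  ≡⟨ cong (λ s → + N ℤ.* x zero ℤ.* + toℕ (VecAll.lookup⁺ b j) ℤ.+ s) (proj₂ (N∈ (z x)) j) ⟩
    _                                              ∎
    where
    open ≡-Reasoning
    split : ∀ a N x x₀ b → a ℤ.* N ℤ.* x ≡ N ℤ.* x₀ ℤ.* b ℤ.+ N ℤ.* (a ℤ.* x ℤ.- x₀ ℤ.* b)
    split = solve-∀

module _ {f} (H : HNF f) where

  private
    S = smithForm (matrix H)
    module S = SmithForm S
    module Q = QuotientProperties S.quotient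

  ⟦*⟧ : ∀ n x i → proj₂ Q.⟦ (λ j → + n ℤ.* x j) ⟧ i ≡ + n ℤ.* proj₂ Q.⟦ x ⟧ i
  ⟦*⟧ zero    x i = trans (proj₂ Q.ε-homo i) (sym (ℤ.*-zeroˡ (proj₂ Q.⟦ x ⟧ i)))
  ⟦*⟧ (suc n) x i = begin
    proj₂ Q.⟦ (λ j → + suc n ℤ.* x j) ⟧ i                        ≡⟨ proj₂ (Q.⟦⟧-cong λ j → distrib (+ n) (x j)) i ⟩
    proj₂ Q.⟦ (λ j → x j ℤ.+ + n ℤ.* x j) ⟧ i                    ≡⟨ proj₂ (Q.homo x λ j → + n ℤ.* x j) i ⟩
    proj₂ Q.⟦ x ⟧ i ℤ.+ proj₂ Q.⟦ (λ j → + n ℤ.* x j) ⟧ i        ≡⟨ cong (λ s → proj₂ Q.⟦ x ⟧ i ℤ.+ s) (⟦*⟧ n x i) ⟩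
    proj₂ Q.⟦ x ⟧ i ℤ.+ + n ℤ.* proj₂ Q.⟦ x ⟧ i                  ≡⟨ distrib (+ n) (proj₂ Q.⟦ x ⟧ i) ⟨
    + suc n ℤ.* proj₂ Q.⟦ x ⟧ i                                  ∎
    where
    open ≡-Reasoning
    distrib : ∀ n x → (1ℤ ℤ.+ n) ℤ.* x ≡ x ℤ.+ n ℤ.* x
    distrib = solve-∀

  -- The exponent from `torsion` annihilates the quotient, but a free coordinate would contain the
  -- element 1, which no nonzero integer annihilates.
  hnf-rank-0 : ¬ Fin S.rank
  hnf-rank-0 i with torsion H
  ... | N , N≢0 , N∈ = N≢0 (ℤ.+-injective (begin
    + N                                          ≡⟨ ℤ.*-identityʳ (+ N) ⟨
    + N ℤ.* 1ℤ                                   ≡⟨ cong (+ N ℤ.*_) (proj₂ (Q.⟦lift⟧ one) i) ⟨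
    + N ℤ.* proj₂ Q.⟦ Q.lift one ⟧ i             ≡⟨ ⟦*⟧ N (Q.lift one) i ⟨
    proj₂ Q.⟦ (λ j → + N ℤ.* Q.lift one j) ⟧ i   ≡⟨ proj₂ (Q.Kernel.from _ (N∈ (Q.lift one))) i ⟩
    0ℤ                                           ∎))
    where
    open ≡-Reasoning
    one = Product.zeros S.nonZero , λ _ → 1ℤ

  foldModuli : List ℕ
  foldModuli = S.invariants

  foldNonZero : All NonZero foldModuli
  foldNonZero = S.nonZero

  foldQuotient : ∀ {Ms} (mzs : All NonZero Ms) →
    Quotient (∏ℤ/ Ms mzs ⊞ ℤ^ f) (λ (x , y) → x ≡ Product.zeros mzs × RowLattice (matrix H) y)
             (∏ℤ/ (Ms ++ foldModuli) (All.++⁺ mzs foldNonZero))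
  foldQuotient {Ms} mzs = record
    { ⟦_⟧ = ⟦_⟧
    ; isGroupHomomorphism = ∙-homo⇒isGroupHomomorphism (∏ℤ/ Ms mzs ⊞ ℤ^ f) (∏ℤ/ (Ms ++ foldModuli) (All.++⁺ mzs foldNonZero)) ⟦_⟧
        (λ { (refl , eq) → cong (All.++⁺ _) (proj₁ (Q.⟦⟧-cong eq)) })
        (λ { (x , y) (x′ , y′) → trans (cong (All.++⁺ _) (proj₁ (Q.homo y y′)))
             (sym (add-++⁺ mzs S.nonZero x _ x′ _)) })
    ; surjective = λ c → (proj₁ (All.++⁻ Ms c) , Q.lift (proj₂ (All.++⁻ Ms c) , λ _ → 0ℤ)) , λ { {x , y} (refl , eq) → trans
        (cong (All.++⁺ _) (trans (proj₁ (Q.⟦⟧-cong eq)) (proj₁ (Q.⟦lift⟧ _))))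
        (Inverse.strictlyInverseˡ (All.++↔ {xs = Ms}) c) }
    ; kernel = λ { (x , y) → mk⇔
        (λ eq → let (eq₁ , eq₂) = ++⁺-injective x _ (trans eq (sym (zeros-++⁺ mzs S.nonZero)))
                in eq₁ , Q.Kernel.to y (eq₂ , λ i → ⊥-elim (hnf-rank-0 i)))
        (λ { (refl , y∈) → trans (cong (All.++⁺ _) (proj₁ (Q.Kernel.from y y∈))) (zeros-++⁺ mzs S.nonZero) }) } }
    where
    ⟦_⟧ : All Fin Ms × (Fin f → ℤ) → All Fin (Ms ++ S.invariants)
    ⟦ x , y ⟧ = All.++⁺ x (proj₁ Q.⟦ y ⟧)

-- Integral cycle bases

module CycleBasis {n} (G : Graph n) where

  open Graph G

  coboundary : (Fin n → ℤ) → E → ℤ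
  coboundary ψ e = ψ (tgt e) ℤ.- ψ (src e)

  -- Orthogonality to all coboundaries characterises the chains with zero boundary.
  Closed : Pred (E → ℤ) 0ℓ
  Closed z = ∀ ψ → ℤΣ.sum (λ e → z e ℤ.* coboundary ψ e) ≡ 0ℤ

  walkChain : ∀ {u v} → Walk u v → E → ℤ
  walkChain w e = walkSum ℤ.+-0-abelianGroup (traversal e) w

  sum-δ : ∀ e (f : E → ℤ) → ℤΣ.sum (λ e′ → δ e′ e ℤ.* f e′) ≡ f e
  sum-δ e f = trans
    (sum-single ℤ.+-0-commutativeMonoid _ e λ e′ e′≢e → cong (ℤ._* f e′) (δ-≢ e′≢e))
    (trans (cong (ℤ._* f e) (δ-refl e)) (ℤ.*-identityˡ (f e)))

  -- A discrete fundamental theorem of calculus: each arc, in either direction, pairs with the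
  -- coboundary to the increment of `ψ` along it.
  telescope : ∀ ψ {u v} (w : Walk u v) → ℤΣ.sum (λ e → walkChain w e ℤ.* coboundary ψ e) ≡ ψ v ℤ.- ψ u
  telescope ψ {u} ε = trans (sum-zero ℤ.+-0-commutativeMonoid _ λ e → ℤ.*-zeroˡ (coboundary ψ e)) (sym (ℤ.+-inverseʳ (ψ u)))
  telescope ψ {u} {v} (_◅_ {j = x} a w) = begin
    ℤΣ.sum (λ e → (traversal e a ℤ.+ walkChain w e) ℤ.* dψ e)
      ≡⟨ ℤΣ.sum-cong-≗ (λ e → ℤ.*-distribʳ-+ (dψ e) (traversal e a) (walkChain w e)) ⟩
    ℤΣ.sum (λ e → traversal e a ℤ.* dψ e ℤ.+ walkChain w e ℤ.* dψ e)
      ≡⟨ ℤΣ.∑-distrib-+ (λ e → traversal e a ℤ.* dψ e) (λ e → walkChain w e ℤ.* dψ e) ⟩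
    ℤΣ.sum (λ e → traversal e a ℤ.* dψ e) ℤ.+ ℤΣ.sum (λ e → walkChain w e ℤ.* dψ e)
      ≡⟨ cong₂ ℤ._+_ (arc a) (telescope ψ w) ⟩
    ψ x ℤ.- ψ u ℤ.+ (ψ v ℤ.- ψ x)
      ≡⟨ cancel (ψ x) (ψ u) (ψ v) ⟩
    ψ v ℤ.- ψ u ∎
    where
    open ≡-Reasoning
    dψ = coboundary ψ
    cancel : ∀ x u v → x ℤ.- u ℤ.+ (v ℤ.- x) ≡ v ℤ.- u
    cancel = solve-∀
    negate : ∀ a b → ℤ.- a ℤ.* b ≡ a ℤ.* (ℤ.- b)
    negate = solve-∀
    flip : ∀ a b → ℤ.- (a ℤ.- b) ≡ b ℤ.- a
    flip = solve-∀
    arc : ∀ {u x} (a : Arc u x) → ℤΣ.sum (λ e → traversal e a ℤ.* dψ e) ≡ ψ x ℤ.- ψ u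
    arc (along e)   = sum-δ e dψ
    arc (against e) = trans (ℤΣ.sum-cong-≗ λ e′ → negate (δ e′ e) (dψ e′))
      (trans (sum-δ e (λ e′ → ℤ.- dψ e′)) (flip (ψ (tgt e)) (ψ (src e))))

  Closed-chain : ∀ {u} (w : Walk u u) → Closed (walkChain w)
  Closed-chain {u} w ψ = trans (telescope ψ w) (ℤ.+-inverseʳ (ψ u))

  Closed-+* : ∀ {z z′} s → Closed z → Closed z′ → Closed (λ e → z e ℤ.+ s ℤ.* z′ e)
  Closed-+* {z} {z′} s cz cz′ ψ = begin
    ℤΣ.sum (λ e → (z e ℤ.+ s ℤ.* z′ e) ℤ.* dψ e)
      ≡⟨ ℤΣ.sum-cong-≗ (λ e → expand (z e) s (z′ e) (dψ e)) ⟩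
    ℤΣ.sum (λ e → z e ℤ.* dψ e ℤ.+ s ℤ.* (z′ e ℤ.* dψ e))
      ≡⟨ ℤΣ.∑-distrib-+ (λ e → z e ℤ.* dψ e) (λ e → s ℤ.* (z′ e ℤ.* dψ e)) ⟩
    ℤΣ.sum (λ e → z e ℤ.* dψ e) ℤ.+ ℤΣ.sum (λ e → s ℤ.* (z′ e ℤ.* dψ e))
      ≡⟨ cong₂ ℤ._+_ (cz ψ) (trans (sym (ℤΣ.*-distribˡ-sum s λ e → z′ e ℤ.* dψ e)) (trans (cong (s ℤ.*_) (cz′ ψ)) (ℤ.*-zeroʳ s))) ⟩
    0ℤ ∎
    where
    open ≡-Reasoning
    dψ = coboundary ψ
    expand : ∀ z s z′ d → (z ℤ.+ s ℤ.* z′) ℤ.* d ≡ z ℤ.* d ℤ.+ s ℤ.* (z′ ℤ.* d)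
    expand = solve-∀

  Below : ℕ → Rel (Fin n) 0ℓ
  Below k u v = Σ[ a ∈ Arc u v ] toℕ (edgeOf a) ℕ.< k

  weaken : ∀ {k u v} → Star (Below k) u v → Star (Below (suc k)) u v
  weaken = gmap id λ (a , lt) → a , ℕ.m<n⇒m<1+n lt

  walkChain-below : ∀ {k u v} (p : Star (Below k) u v) e → k ≤ toℕ e → walkChain (gmap id proj₁ p) e ≡ 0ℤ
  walkChain-below ε e k≤e = refl
  walkChain-below ((a , lt) ◅ p) e k≤e = cong₂ ℤ._+_ (off a lt) (walkChain-below p e k≤e)
    where
    off : ∀ {u v} (a : Arc u v) → toℕ (edgeOf a) ℕ.< _ → traversal e a ≡ 0ℤ
    off (along e′)   lt = δ-≢ {j = e} {e′} λ { refl → ℕ.<⇒≱ lt k≤e }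
    off (against e′) lt = cong ℤ.-_ (δ-≢ {j = e} {e′} λ { refl → ℕ.<⇒≱ lt k≤e })

  -- Refers to the subgraph of the first k edges; component v is a representative
  -- of the component of v, as in a union-find structure.
  record Stage (k : ℕ) : Set where
    field
      component   : Fin n → Fin n
      joined      : ∀ e → toℕ e ℕ.< k → component (src e) ≡ component (tgt e)
      connected   : ∀ {u v} → component u ≡ component v → Star (Below k) u v
      {size}      : ℕ
      cycle       : Fin size → Cycle
      support     : ∀ i e → k ≤ toℕ e → Cycle.chain (cycle i) e ≡ 0ℤ
      independent : ∀ y → (∀ e → combination y (Cycle.chain ∘ cycle) e ≡ 0ℤ) → ∀ i → y i ≡ 0ℤ
      spanning    : ∀ z → Closed z → (∀ e → k ≤ toℕ e → z e ≡ 0ℤ) →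
                    ∃[ y ] (∀ e → z e ≡ combination y (Cycle.chain ∘ cycle) e)

  stage-0 : Stage 0
  stage-0 = record
    { component = id ; joined = λ _ () ; connected = λ { refl → ε }
    ; size = 0 ; cycle = λ () ; support = λ () ; independent = λ _ _ ()
    ; spanning = λ z _ z≡0 → (λ ()) , λ e → z≡0 e z≤n }

  private
    at-or-above : ∀ {P : E → Set} e → P e → (∀ e′ → suc (toℕ e) ≤ toℕ e′ → P e′) → ∀ e′ → toℕ e ≤ toℕ e′ → P e′
    at-or-above e Pe P> e′ e≤e′ with e Fin.≟ e′
    ... | yes refl = Pe
    ... | no e≢e′  = P> e′ (ℕ.≤∧≢⇒< e≤e′ (e≢e′ ∘ Fin.toℕ-injective))

    at-or-below : ∀ {P : E → Set} e → P e → (∀ e′ → toℕ e′ ℕ.< toℕ e → P e′) → ∀ e′ → toℕ e′ ℕ.< suc (toℕ e) → P e′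
    at-or-below e Pe P< e′ (s≤s e′≤e) with e Fin.≟ e′
    ... | yes refl = Pe
    ... | no e≢e′  = P< e′ (ℕ.≤∧≢⇒< e′≤e (≢-sym e≢e′ ∘ Fin.toℕ-injective))

  module Chord (e : E) (st : Stage (toℕ e))
               (same : Stage.component st (src e) ≡ Stage.component st (tgt e)) where

    open Stage st

    private
      path : Σ[ p ∈ Star (Below (toℕ e)) (tgt e) (src e) ] Unique (starts p) × src e ∉ starts p
      path = simplePath Fin._≟_ (connected (sym same))

      p = proj₁ path

      -- Length 0 would make `e` a loop. A single arc would come from a parallel edge: traversed
      -- along, it contradicts `src<tgt`; traversed against, it is `e` itself by `distinct`, which
      -- is not below `e`. The endpoints enter as equations because `src e` and `tgt e` cannot be
      -- unified with those of another edge.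
      long : ∀ {u v} (q : Star (Below (toℕ e)) u v) → u ≡ tgt e → v ≡ src e → 2 ≤ walkLength q
      long ε refl eq = contradiction (src<tgt e) (Fin.<-irrefl (sym eq))
      long ((along e′ , lt) ◅ ε) eq eq′ =
        contradiction (src<tgt e′) (ℕ.<⇒≯ (subst₂ Fin._<_ (sym eq′) (sym eq) (src<tgt e)))
      long ((against e′ , lt) ◅ ε) eq eq′ =
        contradiction lt (ℕ.<-irrefl (cong toℕ (distinct eq′ eq)))
      long (_ ◅ _ ◅ q) eq eq′ = s≤s (s≤s z≤n)

      walk : Walk (tgt e) (src e)
      walk = gmap id proj₁ p

    newCycle : Cycle
    newCycle = record
      { walk = along e ◅ walk
      ; simple = subst (λ xs → Unique (src e ∷ xs)) (sym (starts-gmap proj₁ p))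
          (All.¬Any⇒All¬ _ (proj₂ (proj₂ path)) ∷ proj₁ (proj₂ path))
      ; nontrivial = s≤s (subst (2 ≤_) (sym (walkLength-gmap proj₁ p)) (long p refl refl)) }

    -- Together with the vanishing of all earlier cycles at `e`, this gives the basis a triangular
    -- shape. Independence can be read off at `e`, and since the leading coefficient is 1,
    -- subtracting `z e` copies of the new cycle clears `e` without division.
    chain-top : Cycle.chain newCycle e ≡ 1ℤ
    chain-top = cong₂ ℤ._+_ (δ-refl e) (walkChain-below p e ℕ.≤-refl)

    chain-above : ∀ e′ → suc (toℕ e) ≤ toℕ e′ → Cycle.chain newCycle e′ ≡ 0ℤ
    chain-above e′ lt = cong₂ ℤ._+_ (δ-≢ {j = e′} {e} λ { refl → ℕ.<-irrefl refl lt }) (walkChain-below p e′ (ℕ.<⇒≤ lt))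

    cycle′ : Fin (suc size) → Cycle
    cycle′ zero    = newCycle
    cycle′ (suc i) = cycle i

    combination-top : ∀ y → combination y (Cycle.chain ∘ cycle) e ≡ 0ℤ
    combination-top y = sum-zero ℤ.+-0-commutativeMonoid _ λ i →
      trans (cong (y i ℤ.*_) (support i e ℕ.≤-refl)) (ℤ.*-zeroʳ (y i))

    independent′ : ∀ y → (∀ e → combination y (Cycle.chain ∘ cycle′) e ≡ 0ℤ) → ∀ i → y i ≡ 0ℤ
    independent′ y eq = λ { zero → y₀≡0 ; (suc i) → independent (y ∘ suc) rest i }
      where
      y₀≡0 : y zero ≡ 0ℤ
      y₀≡0 = begin
        y zero                                                                  ≡⟨ ℤ.*-identityʳ (y zero) ⟨
        y zero ℤ.* 1ℤ                                                           ≡⟨ ℤ.+-identityʳ _ ⟨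
        y zero ℤ.* 1ℤ ℤ.+ 0ℤ                                                    ≡⟨ cong₂ (λ a b → y zero ℤ.* a ℤ.+ b) chain-top (combination-top (y ∘ suc)) ⟨
        combination y (Cycle.chain ∘ cycle′) e                                  ≡⟨ eq e ⟩
        0ℤ                                                                      ∎
        where open ≡-Reasoning
      rest : ∀ e′ → combination (y ∘ suc) (Cycle.chain ∘ cycle) e′ ≡ 0ℤ
      rest e′ = trans (sym (ℤ.+-identityˡ _))
        (trans (cong (λ a → a ℤ.* Cycle.chain newCycle e′ ℤ.+ combination (y ∘ suc) (Cycle.chain ∘ cycle) e′) (sym y₀≡0)) (eq e′))

    spanning′ : ∀ z → Closed z → (∀ e′ → suc (toℕ e) ≤ toℕ e′ → z e′ ≡ 0ℤ) →
                ∃[ y ] (∀ e′ → z e′ ≡ combination y (Cycle.chain ∘ cycle′) e′)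
    spanning′ z cz above = coefficients , λ e′ → trans (move (z e′) (z e) (Cycle.chain newCycle e′))
                             (cong (λ s → z e ℤ.* Cycle.chain newCycle e′ ℤ.+ s) (proj₂ reduced e′))
      where
      z′ : E → ℤ
      z′ e′ = z e′ ℤ.+ ℤ.- z e ℤ.* Cycle.chain newCycle e′
      cancel : ∀ a → a ℤ.+ ℤ.- a ℤ.* 1ℤ ≡ 0ℤ
      cancel = solve-∀
      reduced : ∃[ y ] (∀ e′ → z′ e′ ≡ combination y (Cycle.chain ∘ cycle) e′)
      reduced = spanning z′
        (Closed-+* {z} {Cycle.chain newCycle} (ℤ.- z e) cz (Closed-chain (Cycle.walk newCycle)))
        (at-or-above e
          (trans (cong (λ a → z e ℤ.+ ℤ.- z e ℤ.* a) chain-top) (cancel (z e)))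
          (λ e′ lt → trans (cong₂ (λ a b → a ℤ.+ ℤ.- z e ℤ.* b) (above e′ lt) (chain-above e′ lt))
            (trans (ℤ.+-identityˡ _) (ℤ.*-zeroʳ (ℤ.- z e)))))
      coefficients : Fin (suc size) → ℤ
      coefficients zero    = z e
      coefficients (suc i) = proj₁ reduced i
      move : ∀ a b c → a ≡ b ℤ.* c ℤ.+ (a ℤ.+ ℤ.- b ℤ.* c)
      move = solve-∀

    stage : Stage (suc (toℕ e))
    stage = record
      { component = component
      ; joined = at-or-below e same joined
      ; connected = weaken ∘ connected
      ; cycle = cycle′
      ; support = λ where
          zero    → chain-above
          (suc i) → λ e′ lt → support i e′ (ℕ.<⇒≤ lt)
      ; independent = independent′
      ; spanning = spanning′ }

  module Bridge (e : E) (st : Stage (toℕ e))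
                (apart : Stage.component st (src e) ≢ Stage.component st (tgt e)) where

    open Stage st

    private
      s = component (src e)
      t = component (tgt e)

    merge : Fin n → Fin n
    merge c = if does (c Fin.≟ s) then t else c

    ψ : Fin n → ℤ
    ψ v = if does (component v Fin.≟ s) then 1ℤ else 0ℤ

    -- ψ is the indicator function of one side of the bridge, so its coboundary is
    -- supported on e among the edges up to e.
    bridge-0 : ∀ z → Closed z → (∀ e′ → suc (toℕ e) ≤ toℕ e′ → z e′ ≡ 0ℤ) → z e ≡ 0ℤ
    bridge-0 z cz above = ℤ.neg-injective (begin
      ℤ.- z e                                     ≡⟨ negate (z e) ⟩
      z e ℤ.* (0ℤ ℤ.- 1ℤ)                         ≡⟨ cong₂ (λ a b → z e ℤ.* (a ℤ.- b)) ψt ψs ⟨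
      z e ℤ.* coboundary ψ e                      ≡⟨ sum-single ℤ.+-0-commutativeMonoid _ e off ⟨
      ℤΣ.sum (λ e′ → z e′ ℤ.* coboundary ψ e′)    ≡⟨ cz ψ ⟩
      0ℤ                                          ∎)
      where
      open ≡-Reasoning
      negate : ∀ a → ℤ.- a ≡ a ℤ.* (0ℤ ℤ.- 1ℤ)
      negate = solve-∀
      ψs : ψ (src e) ≡ 1ℤ
      ψs with s Fin.≟ s
      ... | yes _  = refl
      ... | no s≢s = contradiction refl s≢s
      ψt : ψ (tgt e) ≡ 0ℤ
      ψt with t Fin.≟ s
      ... | yes t≡s = contradiction (sym t≡s) apart
      ... | no _    = refl
      off : ∀ e′ → e′ ≢ e → z e′ ℤ.* coboundary ψ e′ ≡ 0ℤ
      off e′ e′≢e with ℕ.<-cmp (toℕ e′) (toℕ e)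
      ... | tri< lt _ _ = trans
              (cong (z e′ ℤ.*_) (trans (cong (λ c → (if does (c Fin.≟ s) then 1ℤ else 0ℤ) ℤ.- ψ (src e′)) (sym (joined e′ lt)))
                (ℤ.+-inverseʳ (ψ (src e′)))))
              (ℤ.*-zeroʳ (z e′))
      ... | tri≈ _ eq _ = contradiction (Fin.toℕ-injective eq) e′≢e
      ... | tri> _ _ gt = trans (cong (ℤ._* coboundary ψ e′) (above e′ gt)) (ℤ.*-zeroˡ (coboundary ψ e′))

    merge-s : merge s ≡ t
    merge-s with s Fin.≟ s
    ... | yes _  = refl
    ... | no s≢s = contradiction refl s≢s

    merge-t : merge t ≡ t
    merge-t with t Fin.≟ s
    ... | yes _ = refl
    ... | no _  = refl

    connected′ : ∀ {u v} → merge (component u) ≡ merge (component v) → Star (Below (suc (toℕ e))) u v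
    connected′ {u} {v} eq with component u Fin.≟ s | component v Fin.≟ s
    ... | yes u≡s | yes v≡s = weaken (connected (trans u≡s (sym v≡s)))
    ... | yes u≡s | no _    = weaken (connected u≡s) ◅◅ (along e , ℕ.≤-refl) ◅ weaken (connected eq)
    ... | no _    | yes v≡s = weaken (connected eq) ◅◅ (against e , ℕ.≤-refl) ◅ weaken (connected (sym v≡s))
    ... | no _    | no _    = weaken (connected eq)

    stage : Stage (suc (toℕ e))
    stage = record
      { component = merge ∘ component
      ; joined = at-or-below e (trans merge-s (sym merge-t)) (λ e′ lt → cong merge (joined e′ lt))
      ; connected = connected′
      ; cycle = cycle
      ; support = λ i e′ lt → support i e′ (ℕ.<⇒≤ lt)
      ; independent = independent
      ; spanning = λ z cz above → spanning z cz (at-or-above e (bridge-0 z cz above) above) }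

  stage-suc : ∀ e → Stage (toℕ e) → Stage (suc (toℕ e))
  stage-suc e st with Stage.component st (src e) Fin.≟ Stage.component st (tgt e)
  ... | yes same = Chord.stage e st same
  ... | no apart = Bridge.stage e st apart

  stage-upTo : ∀ k → k ≤ edges → Stage k
  stage-upTo zero    _  = stage-0
  stage-upTo (suc k) k< = subst (Stage ∘ suc) (Fin.toℕ-fromℕ< k<)
    (stage-suc (Fin.fromℕ< k<) (subst Stage (sym (Fin.toℕ-fromℕ< k<)) (stage-upTo k (ℕ.<⇒≤ k<))))

  integralCycleBasis : IntegralCycleBasis
  integralCycleBasis = record
    { cycle = cycle ; independent = independent
    ; spanning = λ Z → spanning (Cycle.chain Z) (Closed-chain (Cycle.walk Z))
        λ e lt → contradiction (Fin.toℕ<n e) (ℕ.≤⇒≯ lt) }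
    where open Stage (stage-upTo edges ℕ.≤-refl)

-- Connection sets

module ConnectionSet {t Ns} (nzs : All NonZero Ns) (g : Fin t → All Fin Ns) where

  private
    Γ = ∏ℤ/ Ns nzs
    module Γ = AbelianGroup Γ
    module ΓP = AbelianGroupProperties Γ

  open AbelianGroup Γ using (Carrier; _∙_; _⁻¹) renaming (ε to 0#)

  S : List Carrier
  S = connectionSet Ns nzs g

  ∈-S⁻ : ∀ {s} → s ∈ S → (∃[ j ] (s ≡ g j ⊎ s ≡ g j ⁻¹)) × s ≢ 0#
  ∈-S⁻ s∈ with ∈-filter⁻ (λ s → ¬? (∏-≟ s 0#)) {xs = concatMap (λ j → g j ∷ g j ⁻¹ ∷ []) (allFin t)} s∈
  ... | s∈′ , s≢0 with find (∈-concatMap⁻ (λ j → g j ∷ g j ⁻¹ ∷ []) {xs = allFin t} s∈′)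
  ...   | j , _ , here eq         = (j , inj₁ eq) , s≢0
  ...   | j , _ , there (here eq) = (j , inj₂ eq) , s≢0

  private
    ∈-S⁺ : ∀ {s} j → s ∈ g j ∷ g j ⁻¹ ∷ [] → s ≢ 0# → s ∈ S
    ∈-S⁺ j s∈ s≢0 = ∈-filter⁺ (λ s → ¬? (∏-≟ s 0#))
      (∈-concatMap⁺ (λ j → g j ∷ g j ⁻¹ ∷ []) (lose (∈-allFin j) s∈)) s≢0

  ∈-S⁺ˡ : ∀ j → g j ≢ 0# → g j ∈ S
  ∈-S⁺ˡ j = ∈-S⁺ j (here refl)

  ∈-S⁺ʳ : ∀ j → g j ⁻¹ ≢ 0# → g j ⁻¹ ∈ S
  ∈-S⁺ʳ j = ∈-S⁺ j (there (here refl))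

  symmetric : ∀ {s} → s ∈ S → s ⁻¹ ∈ S
  symmetric {s} s∈ with ∈-S⁻ s∈
  ... | (j , inj₁ refl) , s≢0 = ∈-S⁺ʳ j λ eq → s≢0 (ΓP.⁻¹-injective (trans eq (sym ΓP.ε⁻¹≈ε)))
  ... | (j , inj₂ refl) , s≢0 = subst (_∈ S) (sym (ΓP.⁻¹-involutive (g j)))
    (∈-S⁺ˡ j λ eq → s≢0 (trans (cong _⁻¹ eq) ΓP.ε⁻¹≈ε))

  Span : Pred Carrier 0ℓ
  Span h = ∃[ ss ] (All (_∈ S) ss × h ≡ foldr _∙_ 0# ss)

  span-0 : Span 0#
  span-0 = [] , [] , refl

  span-∙ : ∀ {h k} → Span h → Span k → Span (h ∙ k)
  span-∙ {k = k} (ss , ss∈ , refl) (ts , ts∈ , refl) = ss ++ ts , All.++⁺ ss∈ ts∈ , append ss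
    where
    append : ∀ ss → foldr _∙_ 0# ss ∙ k ≡ foldr _∙_ 0# (ss ++ ts)
    append []       = Γ.identityˡ k
    append (s ∷ ss) = trans (Γ.assoc s _ k) (cong (s ∙_) (append ss))

  private
    span-S : ∀ {s} → (s ≢ 0# → s ∈ S) → Span s
    span-S {s} s∈ with ∏-≟ s 0#
    ... | yes refl = span-0
    ... | no s≢0   = [ s ] , s∈ s≢0 ∷ [] , sym (Γ.identityʳ s)

  span-g : ∀ j → Span (g j)
  span-g j = span-S (∈-S⁺ˡ j)

  span-g⁻¹ : ∀ j → Span (g j ⁻¹)
  span-g⁻¹ j = span-S (∈-S⁺ʳ j)

  -- Vectors are built from their first coordinate and the rest, with `f` general so that the
  -- induction can continue with the restriction of `f`. Inverses of the generators are assumed to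
  -- lie in the span separately, since `Span` consists of sums without subtraction.
  span-hom : ∀ {m} (f : (Fin m → ℤ) → Carrier) → IsGroupHomomorphism (AbelianGroup.rawGroup (ℤ^ m)) Γ.rawGroup f →
             (∀ j → Span (f (δ j))) → (∀ j → Span (f (δ j) ⁻¹)) → ∀ x → Span (f x)
  span-hom {zero}  f f-hom pos neg x = subst Span (sym (trans (⟦⟧-cong λ ()) ε-homo)) span-0
    where open IsGroupHomomorphism f-hom
  span-hom {suc m} f f-hom pos neg x = subst Span (trans (sym (homo _ _)) (⟦⟧-cong recombine))
    (span-∙ (multiple (x zero))
      (span-hom (f ∘ 0∷_) f′-hom (λ j → subst Span (δ-suc j) (pos (suc j)))
        (λ j → subst Span (cong _⁻¹ (δ-suc j)) (neg (suc j))) (x ∘ suc)))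
    where
    open IsGroupHomomorphism f-hom
    0∷_ : (Fin m → ℤ) → Fin (suc m) → ℤ
    (0∷ y) zero    = 0ℤ
    (0∷ y) (suc j) = y j

    f′-hom : IsGroupHomomorphism (AbelianGroup.rawGroup (ℤ^ m)) Γ.rawGroup (f ∘ 0∷_)
    f′-hom = ∙-homo⇒isGroupHomomorphism (ℤ^ m) Γ (f ∘ 0∷_)
      (λ eq → ⟦⟧-cong λ { zero → refl ; (suc j) → eq j })
      (λ y z → trans (⟦⟧-cong λ { zero → refl ; (suc j) → refl }) (homo (0∷ y) (0∷ z)))

    δ-suc : ∀ j → f (δ (suc j)) ≡ f (0∷ δ j)
    δ-suc j = ⟦⟧-cong λ { zero → refl ; (suc l) → refl }

    infixl 7 _·δ₀
    _·δ₀ : ℤ → Fin (suc m) → ℤ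
    (a ·δ₀) j = a ℤ.* δ zero j

    recombine : ∀ j → (x zero ·δ₀) j ℤ.+ (0∷ (x ∘ suc)) j ≡ x j
    recombine zero    = trans (ℤ.+-identityʳ _) (ℤ.*-identityʳ (x zero))
    recombine (suc j) = trans (cong (ℤ._+ x (suc j)) (ℤ.*-zeroʳ (x zero))) (ℤ.+-identityˡ _)

    multiple : ∀ a → Span (f (a ·δ₀))
    multiple (+ zero)          = subst Span (sym (trans (⟦⟧-cong λ _ → refl) ε-homo)) span-0
    multiple (+ suc k)         = subst Span
      (trans (sym (homo _ _)) (⟦⟧-cong λ j → up (+ k) (δ zero j)))
      (span-∙ (pos zero) (multiple (+ k)))
      where
      up : ∀ k d → d ℤ.+ k ℤ.* d ≡ (1ℤ ℤ.+ k) ℤ.* d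
      up = solve-∀
    multiple (ℤ.-[1+ zero ])   = subst Span
      (trans (sym (⁻¹-homo _)) (⟦⟧-cong λ j → sym (ℤ.-1*i≡-i (δ zero j))))
      (neg zero)
    multiple (ℤ.-[1+ suc k ]) = subst Span
      (trans (cong (_∙ _) (sym (⁻¹-homo _))) (trans (sym (homo _ _)) (⟦⟧-cong λ j → down (+ k) (δ zero j))))
      (span-∙ (neg zero) (multiple (ℤ.-[1+ k ])))
      where
      down : ∀ k d → ℤ.- d ℤ.+ ℤ.- (1ℤ ℤ.+ k) ℤ.* d ≡ ℤ.- (1ℤ ℤ.+ (1ℤ ℤ.+ k)) ℤ.* d
      down = solve-∀

  -- Stating generation through a surjection from `ℤ^ t` serves both kinds of host: for a fold it is
  -- the composite of two quotient maps, for the binary host it first reduces integer coefficients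
  -- modulo 2.
  isConnectionSet : ∀ {n} (φ : Fin n → Carrier) (f : (Fin t → ℤ) → Carrier) →
    IsGroupHomomorphism (AbelianGroup.rawGroup (ℤ^ t)) Γ.rawGroup f →
    (∀ h → ∃[ x ] f x ≡ h) → (∀ j → f (δ j) ≡ g j) →
    Host.IsConnectionSet (record { moduli = Ns ; nonZero = nzs ; S = S ; φ = φ })
  isConnectionSet φ f f-hom f-onto fδ = record
    { symmetric = symmetric
    ; nonzero = λ s∈ → proj₂ (∈-S⁻ s∈)
    ; generating = λ h → subst Span (proj₂ (f-onto h)) (span-hom f f-hom
        (λ j → subst Span (sym (fδ j)) (span-g j))
        (λ j → subst Span (cong _⁻¹ (sym (fδ j))) (span-g⁻¹ j)) (proj₁ (f-onto h))) }

-- The exact check and isometry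

module HostProperties {n} (h : Host n) where

  open Host h
  private
    module Γ = AbelianGroup Γ

  Cay⇔neighbour : ∀ {x y} → Cay x y ⇔ y ∈ List.map (x ∙_) S
  Cay⇔neighbour {x} = mk⇔ (λ { (s , s∈ , refl) → ∈-map⁺ (x ∙_) s∈ }) (∈-map⁻ (x ∙_))

  module CayBFS = BFSCorrectness ∏-≟ (λ x → List.map (x ∙_) S) {R = Cay} Cay⇔neighbour

  Cay-sym : (∀ {s} → s ∈ S → s ⁻¹ ∈ S) → Symmetric Cay
  Cay-sym S-sym {x} (s , s∈ , refl) = s ⁻¹ , S-sym s∈ , sym
    (trans (Γ.assoc x s (s ⁻¹)) (trans (cong (x ∙_) (Γ.inverseʳ s)) (Γ.identityʳ x)))

module _ {n} (G : Graph n) where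

  open Graph G

  Arc-sym : Symmetric Arc
  Arc-sym (along e)   = against e
  Arc-sym (against e) = along e

  module _ (cap : ℕ) (h : Host n) (μ : Algorithm.Metric G cap) where

    open Algorithm G cap
    open Host h
    open HostProperties h
    open Metric μ

    -- The diagonal is trivial, and pairs `v < u` follow by reversing walks on both sides.
    -- Injectivity is a consequence: equal images have Cayley distance 0, and a walk of length 0 in
    -- the graph joins equal vertices.
    exactCheck⇒isometric : IsConnectionSet → ExactCheck μ h → IsIsometricEmbedding h
    exactCheck⇒isometric isC check = injective , λ u v → dist u v , isDistance u v , isometric u v
      where
      ordered : ∀ {u v} → u Fin.< v → Distance Cay (φ u) (φ v) (dist u v)
      ordered u<v = CayBFS.distance-sound _ {depth = diam} (check _ _ u<v)

      isometric : ∀ u v → Distance Cay (φ u) (φ v) (dist u v)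
      isometric u v with Fin.<-cmp u v
      ... | tri< u<v _ _  = ordered u<v
      ... | tri≈ _ refl _ = subst (Distance Cay (φ u) (φ u)) (Distance-unique Distance-refl (isDistance u u)) Distance-refl
      ... | tri> _ _ v<u  = subst (Distance Cay (φ u) (φ v))
        (Distance-unique (Distance-sym Arc-sym (isDistance v u)) (isDistance u v))
        (Distance-sym (Cay-sym (IsConnectionSet.symmetric isC)) (ordered v<u))

      injective : Injective _≡_ _≡_ φ
      injective {u} {v} φu≡φv with isDistance u v
      ... | (w , eq) , _ = at-0 w (trans eq (Distance-unique (isometric u v) (subst (λ y → Distance Cay (φ u) y 0) φu≡φv Distance-refl)))
        where
        at-0 : ∀ {u v} (w : Walk u v) → walkLength w ≡ 0 → u ≡ v
        at-0 ε _ = refl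

    exactCheck? : Dec (ExactCheck μ h)
    exactCheck? = Fin.all? λ u → Fin.all? λ v →
      (u Fin.<? v) →-dec Maybe.≡-dec ℕ._≟_ (bfsDistance diam (φ u) (φ v)) (just (dist u v))

-- The binary host

module 𝔽₂ where
  open AbelianGroup (ℤ/ 2) public
    using (_∙_; _⁻¹; rawMonoid; commutativeMonoid; assoc; comm; identityˡ; identityʳ) renaming (ε to 0#)
  open AbelianGroupProperties (ℤ/ 2) public using (x∙y⁻¹≈ε⇒x≈y; x≈y⇒x∙y⁻¹≈ε)
  open Sum commutativeMonoid public using (sum-cong-≗; ∑-distrib-+; ∑-comm)

  infixl 6 _⊕_
  _⊕_ : Fin 2 → Fin 2 → Fin 2
  _⊕_ = _∙_

  double : ∀ a → a ⊕ a ≡ 0#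
  double zero       = refl
  double (suc zero) = refl

  x⊕yz≡y⊕xz : ∀ x y z → x ⊕ (y ⊕ z) ≡ y ⊕ (x ⊕ z)
  x⊕yz≡y⊕xz x y z = trans (sym (assoc x y z)) (trans (cong (_⊕ z) (comm x y)) (assoc y x z))

  cancel-middle : ∀ a b c → (a ⊕ b) ⊕ (b ⊕ c) ≡ a ⊕ c
  cancel-middle a b c = trans (assoc a b (b ⊕ c))
    (cong (a ⊕_) (trans (sym (assoc b b c)) (trans (cong (_⊕ c) (double b)) (identityˡ c))))

  cancel-left : ∀ a b → a ⊕ (a ⊕ b) ≡ b
  cancel-left a b = trans (sym (assoc a a b)) (trans (cong (_⊕ b) (double a)) (identityˡ b))

  infixr 7 _·_
  _·_ : Fin 2 → Fin 2 → Fin 2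
  zero  · b = zero
  suc _ · b = b

  ·-zeroʳ : ∀ a → a · zero ≡ zero
  ·-zeroʳ zero    = refl
  ·-zeroʳ (suc _) = refl

  ·-one : ∀ a → a · suc zero ≡ a
  ·-one zero       = refl
  ·-one (suc zero) = refl

open 𝔽₂ using (_⊕_; _·_)

δ₂-refl : ∀ {t} (j : Fin t) → δ₂ j j ≡ suc zero
δ₂-refl j with j Fin.≟ j
... | yes _  = refl
... | no j≢j = contradiction refl j≢j

δ₂-≢ : ∀ {t} {j k : Fin t} → j ≢ k → δ₂ j k ≡ zero
δ₂-≢ {j = j} {k} j≢k with j Fin.≟ k
... | yes j≡k = contradiction j≡k j≢k
... | no _    = refl

-- Bit vectors and the cardinality of finite products

bits : (k : ℕ) → List ℕ
bits k = List.replicate k 2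

bits-nonZero : ∀ k → All NonZero (bits k)
bits-nonZero zero    = []
bits-nonZero (suc k) = _ ∷ bits-nonZero k

tabulateBits : ∀ {k} → (Fin k → Fin 2) → All Fin (bits k)
tabulateBits {zero}  f = []
tabulateBits {suc k} f = f zero ∷ tabulateBits (f ∘ suc)

tabulateBits-cong : ∀ {k} {f g : Fin k → Fin 2} → (∀ i → f i ≡ g i) → tabulateBits f ≡ tabulateBits g
tabulateBits-cong {zero}  f≗g = refl
tabulateBits-cong {suc k} f≗g = cong₂ _∷_ (f≗g zero) (tabulateBits-cong (f≗g ∘ suc))

tabulateBits-injective : ∀ {k} {f g : Fin k → Fin 2} → tabulateBits f ≡ tabulateBits g → ∀ i → f i ≡ g i
tabulateBits-injective eq zero    = proj₁ (∷-injective eq)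
tabulateBits-injective eq (suc i) = tabulateBits-injective (proj₂ (∷-injective eq)) i

lookupBits : ∀ {k} → All Fin (bits k) → Fin k → Fin 2
lookupBits (a ∷ as) zero    = a
lookupBits (a ∷ as) (suc i) = lookupBits as i

tabulateBits-lookup : ∀ {k} (as : All Fin (bits k)) → tabulateBits (lookupBits as) ≡ as
tabulateBits-lookup {zero}  []       = refl
tabulateBits-lookup {suc k} (a ∷ as) = cong (a ∷_) (tabulateBits-lookup as)

tabulateBits-⊕ : ∀ {k} (f g : Fin k → Fin 2) →
  tabulateBits (λ i → f i ⊕ g i) ≡ Product.add (bits-nonZero k) (tabulateBits f) (tabulateBits g)
tabulateBits-⊕ {zero}  f g = refl
tabulateBits-⊕ {suc k} f g = cong (λ bs → (f zero ⊕ g zero) ∷ bs) (tabulateBits-⊕ (f ∘ suc) (g ∘ suc))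

tabulateBits-0 : ∀ k → tabulateBits (λ _ → zero) ≡ Product.zeros (bits-nonZero k)
tabulateBits-0 zero    = refl
tabulateBits-0 (suc k) = cong (zero ∷_) (tabulateBits-0 k)

product-bits : ∀ k → product (bits k) ≡ 2 ^ k
product-bits zero    = refl
product-bits (suc k) = cong (2 ℕ.*_) (product-bits k)

-- Mixed-radix numbering: it identifies the order of a product of cyclic groups with a cardinality,
-- so that orders can be compared by the pigeonhole principle.
encode : ∀ {Ns} → All Fin Ns → Fin (product Ns)
encode []       = zero
encode (a ∷ as) = Fin.combine a (encode as)

encode-injective : ∀ {Ns} (as bs : All Fin Ns) → encode as ≡ encode bs → as ≡ bs
encode-injective []       []       eq = refl
encode-injective (a ∷ as) (b ∷ bs) eq with Fin.combine-injective a (encode as) b (encode bs) eq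
... | refl , eq′ = cong (a ∷_) (encode-injective as bs eq′)

decode : ∀ Ns → Fin (product Ns) → All Fin Ns
decode []       _ = []
decode (N ∷ Ns) i = proj₁ (Fin.remQuot {N} (product Ns) i) ∷ decode Ns (proj₂ (Fin.remQuot {N} (product Ns) i))

encode-decode : ∀ Ns i → encode (decode Ns i) ≡ i
encode-decode []       zero = refl
encode-decode (N ∷ Ns) i    = trans
  (cong (Fin.combine (proj₁ (Fin.remQuot {N} (product Ns) i))) (encode-decode Ns _))
  (Fin.combine-remQuot {N} (product Ns) i)

injection⇒product≤ : ∀ {Ms Ns} (f : All Fin Ms → All Fin Ns) → (∀ {x y} → f x ≡ f y → x ≡ y) →
                     product Ms ≤ product Ns
injection⇒product≤ {Ms} f f-inj = Fin.injective⇒≤ {f = encode ∘ f ∘ decode Ms} λ {i} {j} eq →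
  trans (sym (encode-decode Ms i))
    (trans (cong encode (f-inj (encode-injective _ _ eq))) (encode-decode Ms j))

module BinaryHost {n} (G : Graph n) where

  open Graph G

  -- `CycleSpace` unfolds to the kernel of this map, so equality in any binary quotient amounts to
  -- equality of boundaries.
  boundary : (E → Fin 2) → Fin n → Fin 2
  boundary x v = sum 𝔽₂.rawMonoid (λ e → if incident e v then x e else zero)

  private
    if-⊕ : ∀ b (x y : Fin 2) → (if b then x ⊕ y else zero) ≡ (if b then x else zero) ⊕ (if b then y else zero)
    if-⊕ true  x y = refl
    if-⊕ false x y = refl

  boundary-⊕ : ∀ x y v → boundary (λ e → x e ⊕ y e) v ≡ boundary x v ⊕ boundary y v
  boundary-⊕ x y v = trans
    (𝔽₂.sum-cong-≗ λ e → if-⊕ (incident e v) (x e) (y e))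
    (𝔽₂.∑-distrib-+ (λ e → if incident e v then x e else zero) (λ e → if incident e v then y e else zero))

  boundary-hom : IsGroupHomomorphism (AbelianGroup.rawGroup (𝔽₂^ edges)) (AbelianGroup.rawGroup (𝔽₂^ n)) boundary
  boundary-hom = ∙-homo⇒isGroupHomomorphism (𝔽₂^ edges) (𝔽₂^ n) boundary
    (λ x≗y v → 𝔽₂.sum-cong-≗ λ e → cong (if incident e v then_else zero) (x≗y e)) boundary-⊕

  module ∂ = IsGroupHomomorphism boundary-hom

  endpoints : E → Fin n → Fin 2
  endpoints e v = δ₂ (src e) v ⊕ δ₂ (tgt e) v

  -- This depends on the absence of loops: at the vertex of a loop incidence would give 1, but the
  -- two endpoints would sum to 0.
  incident-1 : ∀ e v → (if incident e v then suc zero else zero) ≡ endpoints e v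
  incident-1 e v with src e Fin.≟ v | tgt e Fin.≟ v
  ... | yes refl | yes eq = contradiction (src<tgt e) (Fin.<-irrefl (sym eq))
  ... | yes _    | no _   = refl
  ... | no _     | yes _  = refl
  ... | no _     | no _   = refl

  boundary-δ₂ : ∀ e v → boundary (δ₂ e) v ≡ endpoints e v
  boundary-δ₂ e v = begin
    boundary (δ₂ e) v                              ≡⟨ sum-single 𝔽₂.commutativeMonoid _ e off ⟩
    (if incident e v then δ₂ e e else zero)         ≡⟨ cong (if incident e v then_else zero) (δ₂-refl e) ⟩
    (if incident e v then suc zero else zero)       ≡⟨ incident-1 e v ⟩
    endpoints e v                                  ∎
    where
    open ≡-Reasoning
    off : ∀ e′ → e′ ≢ e → (if incident e′ v then δ₂ e e′ else zero) ≡ zero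
    off e′ e′≢e with incident e′ v
    ... | true  = δ₂-≢ (e′≢e ∘ sym)
    ... | false = refl

  -- Edges are kept in lists with repetitions, since a Cayley walk may use a generator many times
  -- and its length counts every use; only the sum modulo 2 forgets multiplicities.
  edgeSum : List E → E → Fin 2
  edgeSum []       e = zero
  edgeSum (e′ ∷ L) e = δ₂ e′ e ⊕ edgeSum L e

  ends : List E → Fin n → Fin 2
  ends []      v = zero
  ends (e ∷ L) v = endpoints e v ⊕ ends L v

  boundary-edgeSum : ∀ L v → boundary (edgeSum L) v ≡ ends L v
  boundary-edgeSum []      v = ∂.ε-homo v
  boundary-edgeSum (e ∷ L) v = trans (boundary-⊕ (δ₂ e) (edgeSum L) v)
    (cong₂ _⊕_ (boundary-δ₂ e v) (boundary-edgeSum L v))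

  ends-++ : ∀ L L′ v → ends (L ++ L′) v ≡ ends L v ⊕ ends L′ v
  ends-++ []      L′ v = sym (𝔽₂.identityˡ _)
  ends-++ (e ∷ L) L′ v = trans (cong (endpoints e v ⊕_) (ends-++ L L′ v)) (sym (𝔽₂.assoc (endpoints e v) (ends L v) (ends L′ v)))

  trail : ∀ {u v} → Walk u v → List E
  trail ε       = []
  trail (a ◅ w) = edgeOf a ∷ trail w

  length-trail : ∀ {u v} (w : Walk u v) → length (trail w) ≡ walkLength w
  length-trail ε       = refl
  length-trail (a ◅ w) = cong suc (length-trail w)

  endpoints-arc : ∀ {u v} (a : Arc u v) x → endpoints (edgeOf a) x ≡ δ₂ u x ⊕ δ₂ v x
  endpoints-arc (along e)   x = refl
  endpoints-arc (against e) x = 𝔽₂.comm (δ₂ (src e) x) (δ₂ (tgt e) x)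

  ends-trail : ∀ {u v} (w : Walk u v) x → ends (trail w) x ≡ δ₂ u x ⊕ δ₂ v x
  ends-trail {u} ε x = sym (𝔽₂.double (δ₂ u x))
  ends-trail {u} {v} (_◅_ {j = y} a w) x = trans
    (cong₂ _⊕_ (endpoints-arc a x) (ends-trail w x))
    (𝔽₂.cancel-middle (δ₂ u x) (δ₂ y x) (δ₂ v x))

  -- If no edge of `L` met `u`, every summand of `ends L u` would vanish. The list `L′` is `L`
  -- without the edge found.
  extract : ∀ u L → ends L u ≢ zero →
            ∃[ x ] Σ[ a ∈ Arc u x ] ∃[ L′ ] (length L ≡ suc (length L′)) × (∀ y → ends L y ≡ endpoints (edgeOf a) y ⊕ ends L′ y)
  extract u []      odd = contradiction refl odd
  extract u (e ∷ L) odd with src e Fin.≟ u | tgt e Fin.≟ u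
  ... | yes refl | _        = _ , along e , L , refl , λ _ → refl
  ... | no _     | yes refl = _ , against e , L , refl , λ _ → refl
  ... | no _ | no _ with extract u L (odd ∘ trans (𝔽₂.identityˡ (ends L u)))
  ...   | x , a , L′ , len , eq = x , a , e ∷ L′ , cong suc len , λ y →
          trans (cong (endpoints e y ⊕_) (eq y)) (𝔽₂.x⊕yz≡y⊕xz (endpoints e y) (endpoints (edgeOf a) y) (ends L′ y))

  -- While u ≢ v, the degree of u in L is odd: follow an edge of L at u and delete it.
  ends⇒walk : ∀ k L → length L ≡ k → ∀ u v → (∀ x → ends L x ≡ δ₂ u x ⊕ δ₂ v x) →
              Σ[ w ∈ Walk u v ] walkLength w ≤ k
  ends⇒walk k L len u v eq with u Fin.≟ v
  -- The edges still in `L` have zero boundary and are discarded, which is why the length is only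
  -- bounded by `k`.
  ... | yes refl = ε , z≤n
  ... | no u≢v with extract u L odd
    where
    odd : ends L u ≢ zero
    odd even with trans (sym even) (trans (eq u) (cong₂ _⊕_ (δ₂-refl u) (δ₂-≢ (u≢v ∘ sym))))
    ... | ()
  ends⇒walk zero L len u v eq | no u≢v | x , a , L′ , len′ , _ with trans (sym len′) len
  ... | ()
  ends⇒walk (suc k) L len u v eq | no u≢v | x , a , L′ , len′ , eq′
    with ends⇒walk k L′ (ℕ.suc-injective (trans (sym len′) len)) x v rest
    where
    rest : ∀ y → ends L′ y ≡ δ₂ x y ⊕ δ₂ v y
    rest y = begin
      ends L′ y                                              ≡⟨ 𝔽₂.cancel-left ea (ends L′ y) ⟨
      ea ⊕ (ea ⊕ ends L′ y)                                  ≡⟨ cong (ea ⊕_) (eq′ y) ⟨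
      ea ⊕ ends L y                                          ≡⟨ cong₂ _⊕_ (trans (endpoints-arc a y) (𝔽₂.comm (δ₂ u y) (δ₂ x y))) (eq y) ⟩
      (δ₂ x y ⊕ δ₂ u y) ⊕ (δ₂ u y ⊕ δ₂ v y)                  ≡⟨ 𝔽₂.cancel-middle (δ₂ x y) (δ₂ u y) (δ₂ v y) ⟩
      δ₂ x y ⊕ δ₂ v y                                        ∎
      where
      open ≡-Reasoning
      ea = endpoints (edgeOf a) y
  ... | w , w≤k = a ◅ w , s≤s w≤k

  module Embedding (cap : ℕ) (B : Algorithm.BinaryQuotient G cap) (μ : Algorithm.Metric G cap) where

    open Algorithm G cap using (module BinaryQuotient; module Metric; ExactCheck)
    open BinaryQuotient B using (moduli; nonZero; generator; host; labelling)
    open Labelling labelling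
    open QuotientProperties (BinaryQuotient.quotient B)
    open Metric μ
    open Host host using (Cay; φ; Γ; _∙_; _⁻¹; 0#)
    open HostProperties host using (module CayBFS)

    private
      module Γ = AbelianGroup Γ
      module ΓP = AbelianGroupProperties Γ
      module S = ConnectionSet nonZero generator

    label : List E → Host.Carrier host
    label L = ⟦ edgeSum L ⟧

    label-∷ : ∀ e L → label (e ∷ L) ≡ generator e ∙ label L
    label-∷ e L = homo (δ₂ e) (edgeSum L)

    label-++ : ∀ L L′ → label (L ++ L′) ≡ label L ∙ label L′
    label-++ []      L′ = sym (trans (cong (_∙ label L′) ε-homo) (Γ.identityˡ _))
    label-++ (e ∷ L) L′ = trans (label-∷ e (L ++ L′)) (trans (cong (generator e ∙_) (label-++ L L′))
      (trans (sym (Γ.assoc _ _ _)) (cong (_∙ label L′) (sym (label-∷ e L)))))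

    φ≡label : ∀ v → φ v ≡ label (trail (path v))
    φ≡label v = along-walk (path v)
      where
      along-walk : ∀ {u x} (w : Walk u x) → walkSum Γ (λ a → generator (edgeOf a)) w ≡ label (trail w)
      along-walk ε       = sym ε-homo
      along-walk (a ◅ w) = trans (cong (generator (edgeOf a) ∙_) (along-walk w)) (sym (label-∷ (edgeOf a) (trail w)))

    -- Lists with equal labels differ by an element of the cycle space, which the boundary
    -- annihilates.
    label≡⇒ends≗ : ∀ L L′ → label L ≡ label L′ → ∀ v → ends L v ≡ ends L′ v
    label≡⇒ends≗ L L′ eq v = begin
      ends L v                 ≡⟨ boundary-edgeSum L v ⟨
      boundary (edgeSum L) v   ≡⟨ 𝔽₂.x∙y⁻¹≈ε⇒x≈y _ _ difference ⟩
      boundary (edgeSum L′) v  ≡⟨ boundary-edgeSum L′ v ⟩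
      ends L′ v                ∎
      where
      open ≡-Reasoning
      difference : boundary (edgeSum L) v ⊕ 𝔽₂._⁻¹ (boundary (edgeSum L′) v) ≡ zero
      difference = trans (cong (boundary (edgeSum L) v ⊕_) (sym (∂.⁻¹-homo (edgeSum L′) v)))
        (trans (sym (boundary-⊕ (edgeSum L) _ v)) (⟦⟧-injective eq v))

    ends≗⇒label≡ : ∀ L L′ → (∀ v → ends L v ≡ ends L′ v) → label L ≡ label L′
    ends≗⇒label≡ L L′ eq = ⟦⟧-cong-H λ v → trans (boundary-⊕ (edgeSum L) _ v)
      (trans (cong (boundary (edgeSum L) v ⊕_) (∂.⁻¹-homo (edgeSum L′) v))
        (𝔽₂.x≈y⇒x∙y⁻¹≈ε (trans (boundary-edgeSum L v) (trans (eq v) (sym (boundary-edgeSum L′ v))))))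

    -- A single edge has nonzero boundary at `src e`. Consequently the filter in `connectionSet`
    -- drops no generator, and every edge gives a Cayley step.
    generator≢0 : ∀ e → generator e ≢ 0#
    generator≢0 e eq = Fin.0≢1+n (begin
      zero                             ≡⟨ label≡⇒ends≗ (e ∷ []) [] label≡ (src e) ⟨
      ends (e ∷ []) (src e)            ≡⟨ 𝔽₂.identityʳ (endpoints e (src e)) ⟩
      endpoints e (src e)              ≡⟨ cong₂ _⊕_ (δ₂-refl (src e)) (δ₂-≢ λ eq → Fin.<-irrefl (sym eq) (src<tgt e)) ⟩
      suc zero                         ∎)
      where
      open ≡-Reasoning
      label≡ : label (e ∷ []) ≡ label []
      label≡ = trans (label-∷ e []) (trans (cong (_∙ label []) eq) (Γ.identityˡ (label [])))

    generator⁻¹ : ∀ e → generator e ⁻¹ ≡ generator e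
    generator⁻¹ e = trans (sym (⁻¹-homo (δ₂ e))) (⟦⟧-cong λ e′ → negate (δ₂ e e′))
      where
      negate : ∀ a → 𝔽₂._⁻¹ a ≡ a
      negate zero       = refl
      negate (suc zero) = refl

    cayWalk⇒edges : ∀ {x y} (w : Star Cay x y) → ∃[ L ] length L ≡ walkLength w × y ≡ x ∙ label L
    cayWalk⇒edges {x} ε = [] , refl , sym (trans (cong (x ∙_) ε-homo) (Γ.identityʳ x))
    cayWalk⇒edges {x} {y} ((s , s∈ , refl) ◅ w) with cayWalk⇒edges w | S.∈-S⁻ s∈
    ... | L , len , eq | (e , s≡) , _ = e ∷ L , cong suc len , trans eq
      (trans (Γ.assoc x s (label L)) (cong (x ∙_) (trans (cong (_∙ label L) (s≡g s≡)) (sym (label-∷ e L)))))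
      where
      s≡g : s ≡ generator e ⊎ s ≡ generator e ⁻¹ → s ≡ generator e
      s≡g (inj₁ s≡g)   = s≡g
      s≡g (inj₂ s≡g⁻¹) = trans s≡g⁻¹ (generator⁻¹ e)

    edges⇒cayWalk : ∀ L {x y} → y ≡ x ∙ label L → Σ[ w ∈ Star Cay x y ] walkLength w ≡ length L
    edges⇒cayWalk [] {x} {y} eq with trans eq (trans (cong (x ∙_) ε-homo) (Γ.identityʳ x))
    ... | refl = ε , refl
    edges⇒cayWalk (e ∷ L) {x} {y} eq
      with edges⇒cayWalk L (trans eq (trans (cong (x ∙_) (label-∷ e L)) (sym (Γ.assoc x (generator e) (label L)))))
    ... | w , len = (generator e , S.∈-S⁺ˡ e (generator≢0 e) , refl) ◅ w , cong suc len

    -- Both sides compare `path u` followed by `L` with `path v`, by labels on the left and by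
    -- boundaries on the right; the contributions of the root cancel modulo 2. This removes the
    -- arbitrary choice of root and paths from the distance computation.
    reaches⇔ends : ∀ u v L → φ v ≡ φ u ∙ label L ⇔ (∀ x → ends L x ≡ δ₂ u x ⊕ δ₂ v x)
    reaches⇔ends u v L = mk⇔ to from
      where
      pu = trail (path u)
      pv = trail (path v)

      φuL : φ u ∙ label L ≡ label (pu ++ L)
      φuL = trans (cong (_∙ label L) (φ≡label u)) (sym (label-++ pu L))

      to : φ v ≡ φ u ∙ label L → ∀ x → ends L x ≡ δ₂ u x ⊕ δ₂ v x
      to eq x = begin
        ends L x                                               ≡⟨ 𝔽₂.cancel-left (ends pu x) (ends L x) ⟨
        ends pu x ⊕ (ends pu x ⊕ ends L x)                     ≡⟨ cong (ends pu x ⊕_) (ends-++ pu L x) ⟨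
        ends pu x ⊕ ends (pu ++ L) x                           ≡⟨ cong (ends pu x ⊕_) (label≡⇒ends≗ pv (pu ++ L) (trans (sym (φ≡label v)) (trans eq φuL)) x) ⟨
        ends pu x ⊕ ends pv x                                  ≡⟨ cong₂ _⊕_ (trans (ends-trail (path u) x) (𝔽₂.comm (δ₂ root x) (δ₂ u x))) (ends-trail (path v) x) ⟩
        (δ₂ u x ⊕ δ₂ root x) ⊕ (δ₂ root x ⊕ δ₂ v x)            ≡⟨ 𝔽₂.cancel-middle (δ₂ u x) (δ₂ root x) (δ₂ v x) ⟩
        δ₂ u x ⊕ δ₂ v x                                        ∎
        where open ≡-Reasoning

      from : (∀ x → ends L x ≡ δ₂ u x ⊕ δ₂ v x) → φ v ≡ φ u ∙ label L
      from eq = trans (φ≡label v) (trans (ends≗⇒label≡ pv (pu ++ L) λ x → begin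
        ends pv x                                              ≡⟨ ends-trail (path v) x ⟩
        δ₂ root x ⊕ δ₂ v x                                     ≡⟨ 𝔽₂.cancel-middle (δ₂ root x) (δ₂ u x) (δ₂ v x) ⟨
        (δ₂ root x ⊕ δ₂ u x) ⊕ (δ₂ u x ⊕ δ₂ v x)               ≡⟨ cong₂ _⊕_ (ends-trail (path u) x) (eq x) ⟨
        ends pu x ⊕ ends L x                                   ≡⟨ ends-++ pu L x ⟨
        ends (pu ++ L) x                                       ∎) (sym φuL))
        where open ≡-Reasoning

    distance-φ : ∀ u v → Distance Cay (φ u) (φ v) (dist u v)
    distance-φ u v = (proj₁ c , trans (proj₂ c) (trans (length-trail w) (proj₂ (proj₁ (isDistance u v))))) , shortest
      where
      w : Walk u v
      w = proj₁ (proj₁ (isDistance u v))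
      c : Σ[ c ∈ Star Cay (φ u) (φ v) ] walkLength c ≡ length (trail w)
      c = edges⇒cayWalk (trail w) (Equivalence.from (reaches⇔ends u v (trail w)) (ends-trail w))
      shortest : ∀ (c : Star Cay (φ u) (φ v)) → dist u v ≤ walkLength c
      shortest c =
        let (L , len , eq) = cayWalk⇒edges c
            (p , p≤)       = ends⇒walk (walkLength c) L len u v (Equivalence.to (reaches⇔ends u v L) eq)
        in ℕ.≤-trans (proj₂ (isDistance u v) p) p≤

    exactCheck : ExactCheck μ host
    exactCheck u v _ = CayBFS.distance-complete (φ u) (distance-φ u v) (dist≤diam u v)

    isConnectionSet : Host.IsConnectionSet host
    isConnectionSet = S.isConnectionSet φ (λ x → ⟦ residue ∘ x ⟧)
      (∙-homo⇒isGroupHomomorphism (ℤ^ edges) Γ _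
        (λ x≗y → ⟦⟧-cong λ e → cong residue (x≗y e))
        (λ x y → trans (⟦⟧-cong λ e → residue-homo (x e) (y e)) (homo (residue ∘ x) (residue ∘ y))))
      (λ h → (λ e → + toℕ (lift h e)) , trans (⟦⟧-cong λ e → residue-toℕ (lift h e)) (⟦lift⟧ h))
      (λ e → ⟦⟧-cong λ e′ → residue-δ e e′)
      where
      open Reduction 2 _
      residue-δ : ∀ e e′ → residue (δ e e′) ≡ δ₂ e e′
      residue-δ e e′ with does (e Fin.≟ e′)
      ... | true  = refl
      ... | false = refl

-- A binary quotient with one bit per vertex other than the root

module BinaryQuotientExists {k} (G : Graph (suc k)) (connected : Graph.Connected G) where

  open Graph G
  open BinaryHost G

  labelling : Labelling
  labelling = record { root = zero ; path = connected zero }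

  -- The handshake lemma modulo 2: after exchanging the sums, each edge contributes its two
  -- endpoints. It makes the root coordinate of a boundary redundant, so `quotient` omits it.
  sum-boundary : ∀ x → sum 𝔽₂.rawMonoid (boundary x) ≡ zero
  sum-boundary x = trans (𝔽₂.∑-comm (λ v e → if incident e v then x e else zero))
    (sum-zero 𝔽₂.commutativeMonoid _ λ e → per-edge e (x e))
    where
    per-edge : ∀ e a → sum 𝔽₂.rawMonoid (λ v → if incident e v then a else zero) ≡ zero
    per-edge e zero = sum-zero 𝔽₂.commutativeMonoid _ λ v → if-same (incident e v)
      where
      if-same : ∀ b → (if b then zero else zero) ≡ 𝔽₂.0#
      if-same true  = refl
      if-same false = refl
    per-edge e (suc zero) = trans (𝔽₂.sum-cong-≗ (incident-1 e)) (trans (𝔽₂.∑-distrib-+ (δ₂ (src e)) (δ₂ (tgt e)))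
      (cong₂ _⊕_ (point (src e)) (point (tgt e))))
      where
      point : ∀ u → sum 𝔽₂.rawMonoid (δ₂ u) ≡ suc zero
      point u = trans (sum-single 𝔽₂.commutativeMonoid (δ₂ u) u λ v v≢u → δ₂-≢ (v≢u ∘ sym)) (δ₂-refl u)

  boundary-root : ∀ x → (∀ i → boundary x (suc i) ≡ zero) → boundary x zero ≡ zero
  boundary-root x off = trans (sym (𝔽₂.identityʳ _))
    (trans (cong (boundary x zero ⊕_) (sym (sum-zero 𝔽₂.commutativeMonoid _ off))) (sum-boundary x))

  boundary-sum : ∀ {m} (f : Fin m → E → Fin 2) v →
    boundary (λ e → sum 𝔽₂.rawMonoid (λ i → f i e)) v ≡ sum 𝔽₂.rawMonoid (λ i → boundary (f i) v)
  boundary-sum {zero}  f v = ∂.ε-homo v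
  boundary-sum {suc m} f v = trans (boundary-⊕ (f zero) _ v) (cong (boundary (f zero) v ⊕_) (boundary-sum (f ∘ suc) v))

  boundary-· : ∀ a x v → boundary (λ e → a · x e) v ≡ a · boundary x v
  boundary-· zero    x v = ∂.ε-homo v
  boundary-· (suc _) x v = refl

  -- Away from the root, the path from the root to `suc i` has the unit vector at `i` as its
  -- boundary. Sums of these paths therefore realise all values at the non-root vertices.
  preimage : (Fin k → Fin 2) → E → Fin 2
  preimage y e = sum 𝔽₂.rawMonoid (λ i → y i · edgeSum (trail (connected zero (suc i))) e)

  boundary-preimage : ∀ y j → boundary (preimage y) (suc j) ≡ y j
  boundary-preimage y j = begin
    boundary (preimage y) (suc j)                       ≡⟨ boundary-sum (λ i e → y i · p i e) (suc j) ⟩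
    sum 𝔽₂.rawMonoid (λ i → boundary (λ e → y i · p i e) (suc j))  ≡⟨ 𝔽₂.sum-cong-≗ term ⟩
    sum 𝔽₂.rawMonoid (λ i → y i · δ₂ i j)               ≡⟨ sum-single 𝔽₂.commutativeMonoid _ j (λ i i≢j → trans (cong (y i ·_) (δ₂-≢ i≢j)) (𝔽₂.·-zeroʳ (y i))) ⟩
    y j · δ₂ j j                                        ≡⟨ trans (cong (y j ·_) (δ₂-refl j)) (𝔽₂.·-one (y j)) ⟩
    y j                                                 ∎
    where
    open ≡-Reasoning
    p : Fin k → E → Fin 2
    p i = edgeSum (trail (connected zero (suc i)))
    term : ∀ i → boundary (λ e → y i · p i e) (suc j) ≡ y i · δ₂ i j
    term i = trans (boundary-· (y i) (p i) (suc j)) (cong (y i ·_)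
      (trans (boundary-edgeSum (trail (connected zero (suc i))) (suc j))
        (trans (ends-trail (connected zero (suc i)) (suc j)) (𝔽₂.identityˡ (δ₂ i j)))))

  Γ : AbelianGroup 0ℓ 0ℓ
  Γ = ∏ℤ/ (bits k) (bits-nonZero k)

  quotient : Quotient (𝔽₂^ edges) CycleSpace Γ
  quotient = record
    { ⟦_⟧ = ⟦_⟧
    ; isGroupHomomorphism = ∙-homo⇒isGroupHomomorphism (𝔽₂^ edges) Γ ⟦_⟧
        (λ x≗y → tabulateBits-cong λ i → ∂.⟦⟧-cong x≗y (suc i))
        (λ x y → trans (tabulateBits-cong λ i → boundary-⊕ x y (suc i)) (tabulateBits-⊕ _ _))
    ; surjective = λ y → preimage (lookupBits y) , λ z≗ → trans
        (tabulateBits-cong λ i → trans (∂.⟦⟧-cong z≗ (suc i)) (boundary-preimage (lookupBits y) i))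
        (tabulateBits-lookup y)
    ; kernel = λ x → mk⇔
        (λ eq → λ { zero → boundary-root x (kernel⇒ x eq) ; (suc i) → kernel⇒ x eq i })
        (λ cyc → trans (tabulateBits-cong (cyc ∘ suc)) (tabulateBits-0 k)) }
    where
    ⟦_⟧ : (E → Fin 2) → All Fin (bits k)
    ⟦ x ⟧ = tabulateBits (λ i → boundary x (suc i))
    kernel⇒ : ∀ x → ⟦ x ⟧ ≡ Product.zeros (bits-nonZero k) → ∀ i → boundary x (suc i) ≡ zero
    kernel⇒ x eq = tabulateBits-injective (trans eq (sym (tabulateBits-0 k)))

  module _ (cap : ℕ) where

    open Algorithm G cap using (BinaryQuotient; module BinaryQuotient)

    binaryQuotient : BinaryQuotient
    binaryQuotient = record { moduli = bits k ; nonZero = bits-nonZero k ; quotient = quotient ; labelling = labelling }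

    -- Quotients by the same subgroup are isomorphic.
    order-bound : (B : BinaryQuotient) → product (BinaryQuotient.moduli B) ≤ 2 ^ k
    order-bound B = subst (product (BinaryQuotient.moduli B) ≤_) (product-bits k)
      (injection⇒product≤ (λ x → Q₀.⟦ Q.lift x ⟧) λ {x} {y} eq →
        trans (sym (Q.⟦lift⟧ x)) (trans (Q.⟦⟧-cong-H (Q₀.⟦⟧-injective eq)) (Q.⟦lift⟧ y)))
      where
      module Q  = QuotientProperties (BinaryQuotient.quotient B)
      module Q₀ = QuotientProperties quotient

-- Runs of the algorithm

maximum : ∀ {m} (f : Fin (suc m) → ℕ) → ∃[ i ] (∀ j → f j ≤ f i)
maximum {zero}  f = zero , λ { zero → ℕ.≤-refl }
maximum {suc m} f with maximum (f ∘ suc)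
... | i , max with ℕ.≤-total (f zero) (f (suc i))
...   | inj₁ f0≤ = suc i , λ { zero → f0≤ ; (suc j) → max j }
...   | inj₂ ≤f0 = zero , λ { zero → ℕ.≤-refl ; (suc j) → ℕ.≤-trans (max j) ≤f0 }

minimal : ∀ {A : Set} (f : A → ℕ) x xs → ∃[ y ] y ∈ x ∷ xs × All (λ z → f y ≤ f z) (x ∷ xs)
minimal f x []        = x , here refl , ℕ.≤-refl ∷ []
minimal f x (x′ ∷ xs) with minimal f x′ xs
... | y , y∈ , y≤ with ℕ.≤-total (f x) (f y)
...   | inj₁ x≤y = x , here refl , ℕ.≤-refl ∷ All.map (ℕ.≤-trans x≤y) y≤
...   | inj₂ y≤x = y , there y∈ , y≤x ∷ y≤

two-members : ∀ {A : Set} {x y : A} {xs} → x ∈ xs → y ∈ xs → x ≢ y → 2 ≤ length xs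
two-members (here refl)          (here refl)          x≢y = contradiction refl x≢y
two-members (here _)             (there (here _))     x≢y = s≤s (s≤s z≤n)
two-members (here _)             (there (there _))    x≢y = s≤s (s≤s z≤n)
two-members (there (here _))     _                    x≢y = s≤s (s≤s z≤n)
two-members (there (there _))    _                    x≢y = s≤s (s≤s z≤n)

module _ {n} (G : Graph n) where

  open Graph G

  walkOfLength? : ∀ k u v → Dec (Σ[ w ∈ Walk u v ] walkLength w ≡ k)
  walkOfLength? zero u v = map′ (λ { refl → ε , refl }) (λ { (ε , _) → refl }) (u Fin.≟ v)
  walkOfLength? (suc k) u v = map′
    (λ { (e , inj₁ (refl , w , eq)) → along e ◅ w , cong suc eq
       ; (e , inj₂ (refl , w , eq)) → against e ◅ w , cong suc eq })
    (λ { (along e ◅ w , eq)   → e , inj₁ (refl , w , ℕ.suc-injective eq)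
       ; (against e ◅ w , eq) → e , inj₂ (refl , w , ℕ.suc-injective eq) })
    (Fin.any? λ e → ((src e Fin.≟ u) ×-dec walkOfLength? k (tgt e) v)
               ⊎-dec ((tgt e Fin.≟ u) ×-dec walkOfLength? k (src e) v))

  -- Descent from an arbitrary walk: as long as some smaller length is realised, which is decidable,
  -- a walk of that length takes over.
  distance : ∀ {u v} (w : Walk u v) → Acc ℕ._<_ (walkLength w) → ∃[ d ] Distance Arc u v d
  distance {u} {v} w (acc rs) with ℕ.anyUpTo? (λ k → walkOfLength? k u v) (walkLength w)
  ... | yes (_ , lt , w′ , refl) = distance w′ (rs lt)
  ... | no none = walkLength w , (w , refl) , λ w′ → ℕ.≮⇒≥ λ lt → none (_ , lt , w′ , refl)

  -- A choice of one member from each nonempty class is injective.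
  classes≤edges : (P : OrientedPartition) → OrientedPartition.classes P ≤ edges
  classes≤edges P = Fin.injective⇒≤ {f = λ j → proj₁ (nonempty j)} λ {i} {j} eq →
    trans (sym (proj₂ (nonempty i))) (trans (cong class eq) (proj₂ (nonempty j)))
    where open OrientedPartition P

  module _ (P : OrientedPartition) where

    open OrientedPartition P

    private
      Twin : E → E → Set
      Twin e e′ = e ≢ e′ × class e ≡ class e′

      twin? : ∀ e e′ → Dec (Twin e e′)
      twin? e e′ = ¬? (e Fin.≟ e′) ×-dec (class e Fin.≟ class e′)

    allSingletons? : AllSingletons ⊎ (∃[ e ] ∃[ e′ ] Twin e e′)
    allSingletons? with Fin.any? (λ e → Fin.any? (twin? e))
    ... | yes twins = inj₂ twins
    ... | no  none  = inj₁ λ {e} {e′} same → decidable-stable (e Fin.≟ e′) λ e≢e′ → none (e , e′ , e≢e′ , same)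

    -- The given twins need not lie in a largest class, but they show that such a class has at least
    -- two members. Its first two listed members are distinct because the list has no repetitions;
    -- one is the edge to peel and the other keeps the old class nonempty.
    largest-class : ∃[ e ] ∃[ e′ ] Twin e e′ →
      ∃[ e ] ∃[ e′ ] Twin e e′ × (∀ j → classSize j ≤ classSize (class e))
    largest-class (e₀ , e₁ , e₀≢e₁ , same) = pick (maximal (class e₀) classSize)
      where
      maximal : ∀ {m} → Fin m → (f : Fin m → ℕ) → ∃[ i ] (∀ j → f j ≤ f i)
      maximal {suc m} _ = maximum

      members : Fin classes → List E
      members j = filter (λ e → class e Fin.≟ j) (allFin edges)

      size₀ : 2 ≤ classSize (class e₀)
      size₀ = two-members (∈-filter⁺ (λ e → class e Fin.≟ class e₀) (∈-allFin e₀) refl)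
        (∈-filter⁺ (λ e → class e Fin.≟ class e₀) (∈-allFin e₁) (sym same)) e₀≢e₁

      pick : ∃[ j ] (∀ i → classSize i ≤ classSize j) →
             ∃[ e ] ∃[ e′ ] Twin e e′ × (∀ j → classSize j ≤ classSize (class e))
      pick (j , max) = first-two (members j) refl (Unique.filter⁺ (λ e → class e Fin.≟ j) (Unique.allFin⁺ edges))
                         (ℕ.≤-trans size₀ (max (class e₀)))
        where
        ∈-class : ∀ {e} → e ∈ members j → class e ≡ j
        ∈-class e∈ = proj₂ (∈-filter⁻ (λ e → class e Fin.≟ j) {xs = allFin edges} e∈)
        first-two : ∀ es → members j ≡ es → Unique es → 2 ≤ length es →
                    ∃[ e ] ∃[ e′ ] Twin e e′ × (∀ j → classSize j ≤ classSize (class e))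
        first-two (_ ∷ []) _ _ (s≤s ())
        first-two (e ∷ e′ ∷ es) eq ((e≢e′ ∷ _) ∷ _) _ =
          e , e′ , (e≢e′ , trans class-e (sym (∈-class (subst (e′ ∈_) (sym eq) (there (here refl)))))) ,
          subst (λ j → ∀ i → classSize i ≤ classSize j) (sym class-e) max
          where
          class-e : class e ≡ j
          class-e = ∈-class (subst (e ∈_) (sym eq) (here refl))

module Run {k} (G : Graph (suc k)) (connected : Graph.Connected G) (cap : ℕ) where

  open Graph G
  open Algorithm G cap
  open OrientedPartition using (class; classes; AllSingletons)

  metric : Metric
  metric = record
    { dist = dist ; isDistance = λ u v → proj₂ (shortest u v)
    ; diam = dist u₀ (v₀ u₀)
    ; dist≤diam = λ u v → ℕ.≤-trans (proj₂ (maximum (dist u)) v) (proj₂ (maximum λ u → dist u (v₀ u)) u)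
    ; diam-attained = u₀ , v₀ u₀ , refl }
    where
    shortest : ∀ u v → ∃[ d ] Distance Arc u v d
    shortest u v = distance G (connected u v) (<-wellFounded _)
    dist : Fin (suc k) → Fin (suc k) → ℕ
    dist u v = proj₁ (shortest u v)
    v₀ : Fin (suc k) → Fin (suc k)
    v₀ u = proj₁ (maximum (dist u))
    u₀ : Fin (suc k)
    u₀ = proj₁ (maximum λ u → dist u (v₀ u))

  universalGroup : ∀ P → UniversalGroup P
  universalGroup P = record
    { basis = basis ; invariants = invariants ; nonZero = nonZero ; divisible = divisible ; rank = rank
    ; quotient = quotient ; labelling = BinaryQuotientExists.labelling G connected }
    where
    basis = CycleBasis.integralCycleBasis G
    open SmithForm (smithForm (OrientedPartition.cycleClassMatrix P basis))

  hnfFold : ∀ {P} (U : UniversalGroup P) H → Fold U H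
  hnfFold U H = record
    { moduli = invariants ++ foldModuli H ; nonZero = All.++⁺ nonZero (foldNonZero H) ; quotient = foldQuotient H nonZero }
    where open UniversalGroup U

  fold-isConnectionSet : ∀ {P} {U : UniversalGroup P} {H} (F : Fold U H) → Host.IsConnectionSet (Fold.host F)
  fold-isConnectionSet {P} {U} F = ConnectionSet.isConnectionSet (Fold.nonZero F) (λ j → Q.⟦ R.⟦ δ j ⟧ ⟧)
    (Host.φ (Fold.host F)) (λ x → Q.⟦ R.⟦ x ⟧ ⟧)
    (∙-homo⇒isGroupHomomorphism (ℤ^ (classes P)) (Host.Γ (Fold.host F)) _
      (λ x≗y → Q.⟦⟧-cong (R.⟦⟧-cong x≗y))
      (λ x y → trans (Q.⟦⟧-cong (R.homo x y)) (Q.homo R.⟦ x ⟧ R.⟦ y ⟧)))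
    (λ h → R.lift (Q.lift h) , trans (Q.⟦⟧-cong (R.⟦lift⟧ (Q.lift h))) (Q.⟦lift⟧ h))
    (λ _ → refl)
    where
    module Q = QuotientProperties (Fold.quotient F)
    module R = QuotientProperties (UniversalGroup.quotient U)

  -- Invariant of the recorded hosts. It leaves out the order bound, since folds are searched up to
  -- `cap`, which is not compared with `2 ^ k`; the bound enters with the binary host at selection.
  Verified : Metric → Host (suc k) → Set
  Verified μ h = ExactCheck μ h × IsIsometricEmbedding h × Host.IsConnectionSet h

  verified : ∀ μ h → Host.IsConnectionSet h → ExactCheck μ h → Verified μ h
  verified μ h isC check = check , exactCheck⇒isometric G cap h μ isC check , isC

  Post : Metric → Host (suc k) → Set
  Post μ h = ExactCheck μ h × IsIsometricEmbedding h × Host.IsConnectionSet h × Host.order h ≤ 2 ^ k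

  Returns : State → Set
  Returns = EveryRunReturns Post

  returns-select : ∀ {μ h hs} → All (Verified μ) (h ∷ hs) → Host.order h ≤ 2 ^ k → Returns (select μ (h ∷ hs))
  returns-select {μ} {h} {hs} ok order≤ = step
    (let (h₀ , h₀∈ , min) = minimal Host.order h hs in return μ h₀ , smallest h₀∈ min)
    λ { (smallest h₀∈ (min ∷ _)) → returned
          (let (check , iso , isC) = All.lookup ok h₀∈ in check , iso , isC , ℕ.≤-trans min order≤) }

  -- `continue` here and `peeled` below stand for the two recursive calls, on the rest of the
  -- portfolio and on a partition with one more class. Abstracting them keeps the two inductions
  -- apart.
  module _ {μ : Metric} {ps : Portfolio}
           (continue : ∀ {hs} → All (Verified μ) hs → Returns (portfolio μ ps hs)) where

    module _ {P : OrientedPartition} {hs} (ok : All (Verified μ) hs)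
             (peeled : ∀ {P′} → classes P′ ≡ suc (classes P) → Returns (loop μ P′ ps hs)) where

      returns-repair : Returns (repair μ P ps hs)
      returns-repair = step progress λ
        { (peel-edge e e′ e≢e′ same _) → returns-repaired (peel P e e′ e≢e′ same) λ _ → peeled refl
        -- The partition is unchanged here, so another pass would make no progress; `again` is
        -- excluded because all classes are singletons.
        ; (nothing-to-peel singletons) → returns-repaired P λ ¬singletons → ⊥-elim (¬singletons singletons) }
        where
        progress : ∃[ s ] repair μ P ps hs ⟶ s
        progress with allSingletons? G P
        ... | inj₁ singletons = _ , nothing-to-peel singletons
        ... | inj₂ twins      = let (e , e′ , (e≢e′ , same) , max) = largest-class G P twins
                                in _ , peel-edge e e′ e≢e′ same max

        returns-repaired : ∀ P′ → (¬ AllSingletons P′ → Returns (loop μ P′ ps hs)) → Returns (repaired μ P′ ps hs)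
        returns-repaired P′ rerun = step progress′ λ
          { (leave _)           → continue ok
          ; (again ¬singletons) → rerun ¬singletons }
          where
          progress′ : ∃[ s ] repaired μ P′ ps hs ⟶ s
          progress′ with allSingletons? G P′
          ... | inj₁ singletons                = _ , leave singletons
          ... | inj₂ (e , e′ , e≢e′ , same) = _ , again λ singletons → e≢e′ (singletons same)

      returns-folding : ∀ U Hs → Returns (folding μ P U Hs ps hs)
      returns-folding U []       = step (_ , exhausted) λ { exhausted → returns-repair }
      returns-folding U (H ∷ Hs) = step progress λ
        { (fold-pass F check) → continue (verified μ (Fold.host F) (fold-isConnectionSet F) check ∷ ok)
        ; (fold-fail F _)     → returns-folding U Hs }
        where
        progress : ∃[ s ] folding μ P U (H ∷ Hs) ps hs ⟶ s
        progress with exactCheck? G cap (Fold.host (hnfFold U H)) μ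
        ... | yes check = _ , fold-pass (hnfFold U H) check
        ... | no ¬check = _ , fold-fail (hnfFold U H) ¬check

    -- Each pass of the loop splits off a new class, and there are at most as many classes as edges.
    returns-loop : ∀ m {P hs} → edges ≤ m ℕ.+ classes P → All (Verified μ) hs → Returns (loop μ P ps hs)
    returns-loop m {P} {hs} bound ok =
      step (_ , universal (universalGroup P)) λ { (universal U) → returns-folding ok (peeled m bound) U _ }
      where
      peeled : ∀ m → edges ≤ m ℕ.+ classes P → ∀ {P′} → classes P′ ≡ suc (classes P) → Returns (loop μ P′ ps hs)
      peeled zero    bound {P′} eq = contradiction (subst (_≤ edges) eq (classes≤edges G P′)) (ℕ.≤⇒≯ bound)
      peeled (suc m) bound {P′} eq = returns-loop m
        (ℕ.≤-trans bound (ℕ.≤-reflexive (trans (sym (ℕ.+-suc m (classes P))) (cong (m ℕ.+_) (sym eq))))) ok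

  returns-portfolio : ∀ {μ} ps {hs} → All (Verified μ) hs → Returns (portfolio μ ps hs)
  returns-portfolio {μ} [] ok = step
    (_ , terminal-pass B₀ (BinaryHost.Embedding.exactCheck G cap B₀ μ)) λ
    { (terminal-pass B check) → returns-select
        (verified μ (BinaryQuotient.host B) (BinaryHost.Embedding.isConnectionSet G cap B μ) check ∷ ok)
        (BinaryQuotientExists.order-bound G connected cap B)
    ; (terminal-fail B ¬check) → ⊥-elim (¬check (BinaryHost.Embedding.exactCheck G cap B μ)) }
    where
    B₀ = BinaryQuotientExists.binaryQuotient G connected cap
  returns-portfolio (P ∷ ps) ok = step (_ , next) λ { next →
    returns-loop (returns-portfolio ps) edges (ℕ.m≤m+n edges (classes P)) ok }

  returns-start : Returns start
  returns-start = step (_ , measure metric) λ { (measure μ) →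
    step (_ , build []) λ { (build ps) → returns-portfolio ps [] } }

theorem10 : ∀ {n : ℕ} .{{_ : NonZero n}} (G : Graph n) → Graph.Connected G → (cap : ℕ) →
    Algorithm.EveryRunReturns G cap
    (λ μ h → Algorithm.ExactCheck G cap μ h ×
    Algorithm.IsIsometricEmbedding G cap h ×
    Host.IsConnectionSet h ×
    Host.order h ≤ 2 ^ (n ∸ 1))
    (Algorithm.start {G = G} {cap = cap})
theorem10 {suc k} G connected cap = Run.returns-start G connected cap
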